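{- $\mathrm{GRA}(e,p,s,I,J,\exists)$ is equiexpressive with the set of conjunctive queries with equality ($\mathrm{CQE}$s). Also, $\mathrm{GRA}(p,s,I,J,\exists)$ is equiexpressive with the set of conjunctive queries ($\mathrm{CQ}$s).
   Context: AD-relations. $A^0=\{\epsilon\}$, with $\epsilon$ the empty tuple. A $k$-ary AD-relation over a set $A$ is a pair $(R,k)$ with $R\subseteq A^k$, $k\ge 0$; $t\in(R,k)$ means $t\in R$. Vocabularies contain only relation symbols (of any arity $k\ge 0$). Models have nonempty domains; $A$ is the domain of $\mathfrak{A}$. Terms. $\mathrm{GRA}(e,p,s,I,J,\exists)$ is the set of terms built from relation symbols and the constant $e$ by the unary operators $p,s,I,\exists$ and the binary operator $J$; $\mathrm{GRA}(p,s,I,J,\exists)$ is the set of those terms not using $e$. Each term $\mathcal{T}$ defines in each model $\mathfrak{A}$ an AD-relation $\mathcal{T}^{\mathfrak{A}}$ of arity $\mathit{ar}(\mathcal{T})$. Let $k=\mathit{ar}(\mathcal{T})$, $\ell=\mathit{ar}(\mathcal{S})$. - $R^{\mathfrak{A}}$ is the interpretation of $R$, paired with the arity of $R$; $e^{\mathfrak{A}}=(\{(a,a)\mid a\in A\},2)$. - If $k\ge2$: $(p\mathcal{T})^{\mathfrak{A}}=(\{(a_k,a_1,\dots,a_{k-1})\mid(a_1,\dots,a_k)\in\mathcal{T}^{\mathfrak{A}}\},k)$; $(s\mathcal{T})^{\mathfrak{A}}=(\{(a_1,\dots,a_{k-2},a_k,a_{k-1})\mid(a_1,\dots,a_k)\in\mathcal{T}^{\mathfrak{A}}\},k)$;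 $(I\mathcal{T})^{\mathfrak{A}}=(\{(a_1,\dots,a_{k-1})\mid(a_1,\dots,a_k)\in\mathcal{T}^{\mathfrak{A}},\ a_{k-1}=a_k\},k-1)$. If $k\le1$, each of $p\mathcal{T},s\mathcal{T},I\mathcal{T}$ is interpreted as $\mathcal{T}^{\mathfrak{A}}$. - $(J(\mathcal{T},\mathcal{S}))^{\mathfrak{A}}=(\{(a_1,\dots,a_k,b_1,\dots,b_\ell)\mid(a_1,\dots,a_k)\in\mathcal{T}^{\mathfrak{A}},(b_1,\dots,b_\ell)\in\mathcal{S}^{\mathfrak{A}}\},k+\ell)$. - If $k\ge1$: $(\exists\mathcal{T})^{\mathfrak{A}}=(\{(a_1,\dots,a_{k-1})\mid(a_1,\dots,a_k)\in\mathcal{T}^{\mathfrak{A}}\text{ for some }a_k\in A\},k-1)$; if $k=0$: $(\exists\mathcal{T})^{\mathfrak{A}}=\mathcal{T}^{\mathfrak{A}}$. Formulas. Variables are $v_1,v_2,\dots$. A conjunctive query (CQ) is a formula $\exists x_1\dots\exists x_k\,\psi$ where $\psi$ is a conjunction of relation atoms $R(y_1,\dots,y_n)$. A conjunctive query with equality (CQE) is like a CQ but also allows equality atoms in addition to relation atoms. A formula $\varphi$ whose free variables are exactly $v_{i_1},\dots,v_{i_k}$ with $i_1<\dots<i_k$ defines $\varphi^{\mathfrak{A}}=(\{(a_1,\dots,a_k)\in A^k\mid\mathfrak{A}\models\varphi(a_1,\dots,a_k)\},k)$, where $a_j$ is assigned to $v_{i_j}$. A formula $\varphi$ and a term $\mathcal{T}$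 are equivalent if $\varphi^{\mathfrak{A}}=\mathcal{T}^{\mathfrak{A}}$ for every model $\mathfrak{A}$ whose vocabulary contains all symbols of $\varphi$ and $\mathcal{T}$. A set of terms and a set of formulas are equiexpressive if each term in the former has an equivalent formula in the latter and each formula in the latter has an equivalent term in the former. -}

module Defs where

open import Data.Empty.Polymorphic using (⊥)
open import Data.List using (List; []; _∷_; _++_; length; filter; deduplicate)
open import Data.List.Sort using (sort)
open import Data.Nat using (ℕ; zero; suc; _+_; _≟_)
open import Data.Nat.Properties using (≤-decTotalOrder)
open import Data.Product using (Σ; ∃-syntax; _×_; _,_; proj₁; proj₂)
open import Data.Unit.Polymorphic using (⊤)
open import Data.Vec as Vec using (Vec; []; _∷_; _∷ʳ_)
open import Level using (Level; 0ℓ; _⊔_) renaming (suc to lsuc)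
open import Relation.Binary.PropositionalEquality using (_≡_)
open import Relation.Nullary using (¬?; does)
open import Relation.Unary using (Pred; _∈_; _≐_; U)
open import Data.Bool using (if_then_else_)

private
  variable
    σ ℓ : Level

-- The supply of all relation symbols; a vocabulary is a subset of it.
record RelationSymbols (σ : Level) : Set (lsuc σ) where
  field
    Symbol : Set σ
    arity  : Symbol → ℕ

open RelationSymbols public

-- Membership in the vocabulary is an irrelevant argument of `interp`, so that
-- each symbol of the vocabulary has a single interpretation.
record Model (𝓢 : RelationSymbols σ) (ℓ : Level) : Set (σ ⊔ lsuc ℓ) where
  field
    Domain     : Set ℓ
    nonempty   : Domain
    vocabulary : Pred (Symbol 𝓢) ℓ
    interp     : (R : Symbol 𝓢) → .(R ∈ vocabulary) →
                 Pred (Vec Domain (arity 𝓢 R)) ℓ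

open Model public

ADRel : Set ℓ → Set (lsuc ℓ)
ADRel {ℓ} A = Σ ℕ λ k → Pred (Vec A k) ℓ

data _≋_ {A : Set ℓ} : ADRel A → ADRel A → Set (lsuc ℓ) where
  same : ∀ {k} {R S : Pred (Vec A k) ℓ} → R ≐ S → (k , R) ≋ (k , S)

module _ {A : Set ℓ} where

  identityᴬ : ADRel A
  identityᴬ = 2 , λ t → ∃[ a ] t ≡ a ∷ a ∷ []

  pᴬ : ADRel A → ADRel A
  pᴬ (zero , R)        = zero , R
  pᴬ (suc zero , R)    = suc zero , R
  pᴬ (suc (suc k) , R) = suc (suc k) , λ t →
    ∃[ as ] ∃[ a ] (t ≡ a ∷ as × as ∷ʳ a ∈ R)

  sᴬ : ADRel A → ADRel A
  sᴬ (zero , R)        = zero , R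
  sᴬ (suc zero , R)    = suc zero , R
  sᴬ (suc (suc k) , R) = suc (suc k) , λ t →
    ∃[ as ] ∃[ a ] ∃[ b ] (t ≡ as ∷ʳ b ∷ʳ a × as ∷ʳ a ∷ʳ b ∈ R)

  Iᴬ : ADRel A → ADRel A
  Iᴬ (zero , R)        = zero , R
  Iᴬ (suc zero , R)    = suc zero , R
  Iᴬ (suc (suc k) , R) = suc k , λ t →
    ∃[ as ] ∃[ a ] ∃[ b ] (t ≡ as ∷ʳ a × as ∷ʳ a ∷ʳ b ∈ R × a ≡ b)

  Jᴬ : ADRel A → ADRel A → ADRel A
  Jᴬ (k , R) (l , S) = k + l , λ t →
    ∃[ as ] ∃[ bs ] (t ≡ as Vec.++ bs × as ∈ R × bs ∈ S)

  ∃ᴬ : ADRel A → ADRel A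
  ∃ᴬ (zero , R)  = zero , R
  ∃ᴬ (suc k , R) = k , λ as → ∃[ a ] (as ∷ʳ a ∈ R)

data Term (𝓢 : RelationSymbols σ) : Set σ where
  rel  : Symbol 𝓢 → Term 𝓢
  e    : Term 𝓢
  p    : Term 𝓢 → Term 𝓢
  s    : Term 𝓢 → Term 𝓢
  I    : Term 𝓢 → Term 𝓢
  J    : Term 𝓢 → Term 𝓢 → Term 𝓢
  ∃ᵗ   : Term 𝓢 → Term 𝓢

module _ {𝓢 : RelationSymbols σ} where

  GRA[e,p,s,I,J,∃] : Pred (Term 𝓢) 0ℓ
  GRA[e,p,s,I,J,∃] = U

  GRA[p,s,I,J,∃] : Pred (Term 𝓢) 0ℓ
  GRA[p,s,I,J,∃] (rel R)  = ⊤
  GRA[p,s,I,J,∃] e        = ⊥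
  GRA[p,s,I,J,∃] (p T)    = GRA[p,s,I,J,∃] T
  GRA[p,s,I,J,∃] (s T)    = GRA[p,s,I,J,∃] T
  GRA[p,s,I,J,∃] (I T)    = GRA[p,s,I,J,∃] T
  GRA[p,s,I,J,∃] (J T T′) = GRA[p,s,I,J,∃] T × GRA[p,s,I,J,∃] T′
  GRA[p,s,I,J,∃] (∃ᵗ T)   = GRA[p,s,I,J,∃] T

  -- All relation symbols of the term belong to the vocabulary τ.
  _overᵗ_ : Term 𝓢 → Pred (Symbol 𝓢) ℓ → Set ℓ
  rel R  overᵗ τ = R ∈ τ
  e      overᵗ τ = ⊤
  p T    overᵗ τ = T overᵗ τ
  s T    overᵗ τ = T overᵗ τ
  I T    overᵗ τ = T overᵗ τ
  J T T′ overᵗ τ = T overᵗ τ × T′ overᵗ τ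
  ∃ᵗ T   overᵗ τ = T overᵗ τ

  ⟦_⟧ᵗ : (T : Term 𝓢) (𝔄 : Model 𝓢 ℓ) → .(T overᵗ vocabulary 𝔄) →
         ADRel (Domain 𝔄)
  ⟦ rel R ⟧ᵗ  𝔄 o = arity 𝓢 R , interp 𝔄 R o
  ⟦ e ⟧ᵗ      𝔄 o = identityᴬ
  ⟦ p T ⟧ᵗ    𝔄 o = pᴬ (⟦ T ⟧ᵗ 𝔄 o)
  ⟦ s T ⟧ᵗ    𝔄 o = sᴬ (⟦ T ⟧ᵗ 𝔄 o)
  ⟦ I T ⟧ᵗ    𝔄 o = Iᴬ (⟦ T ⟧ᵗ 𝔄 o)
  ⟦ J T T′ ⟧ᵗ 𝔄 o = Jᴬ (⟦ T ⟧ᵗ 𝔄 (proj₁ o)) (⟦ T′ ⟧ᵗ 𝔄 (proj₂ o))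
  ⟦ ∃ᵗ T ⟧ᵗ   𝔄 o = ∃ᴬ (⟦ T ⟧ᵗ 𝔄 o)

-- The number i stands for the variable vᵢ₊₁.
Var : Set
Var = ℕ

-- Only the fragment containing the conjunctive queries.
data Formula (𝓢 : RelationSymbols σ) : Set σ where
  atom : (R : Symbol 𝓢) → Vec Var (arity 𝓢 R) → Formula 𝓢
  _≗_  : Var → Var → Formula 𝓢
  _∧_  : Formula 𝓢 → Formula 𝓢 → Formula 𝓢
  ∃ᶠ   : Var → Formula 𝓢 → Formula 𝓢

module _ {𝓢 : RelationSymbols σ} where

  data RelationAtom : Pred (Formula 𝓢) σ where
    atom : ∀ R xs → RelationAtom (atom R xs)

  data RelationOrEqualityAtom : Pred (Formula 𝓢) σ where
    atom : ∀ R xs → RelationOrEqualityAtom (atom R xs)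
    _≗_  : ∀ x y → RelationOrEqualityAtom (x ≗ y)

  -- Conjunctions of at least one formula in P.
  data ConjunctionOf (P : Pred (Formula 𝓢) σ) : Pred (Formula 𝓢) σ where
    single : ∀ {φ} → φ ∈ P → ConjunctionOf P φ
    _∧_    : ∀ {φ ψ} → ConjunctionOf P φ → ConjunctionOf P ψ →
             ConjunctionOf P (φ ∧ ψ)

  -- Formulas ∃x₁ … ∃xₖ ψ with k ≥ 0 and ψ in P.
  data ExistentialOf (P : Pred (Formula 𝓢) σ) : Pred (Formula 𝓢) σ where
    matrix : ∀ {ψ} → ψ ∈ P → ExistentialOf P ψ
    ∃ᶠ     : ∀ x {φ} → ExistentialOf P φ → ExistentialOf P (∃ᶠ x φ)

  CQ : Pred (Formula 𝓢) σ
  CQ = ExistentialOf (ConjunctionOf RelationAtom)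

  CQE : Pred (Formula 𝓢) σ
  CQE = ExistentialOf (ConjunctionOf RelationOrEqualityAtom)

  freeOccurrences : Formula 𝓢 → List Var
  freeOccurrences (atom R xs) = Vec.toList xs
  freeOccurrences (x ≗ y)     = x ∷ y ∷ []
  freeOccurrences (φ ∧ ψ)     = freeOccurrences φ ++ freeOccurrences ψ
  freeOccurrences (∃ᶠ x φ)    =
    filter (λ y → ¬? (y ≟ x)) (freeOccurrences φ)

  -- The free variables, in strictly increasing order of their indices.
  freeVars : Formula 𝓢 → List Var
  freeVars φ = sort ≤-decTotalOrder (deduplicate _≟_ (freeOccurrences φ))

  -- All relation symbols of the formula belong to the vocabulary τ.
  _overᶠ_ : Formula 𝓢 → Pred (Symbol 𝓢) ℓ → Set ℓ
  atom R xs overᶠ τ = R ∈ τ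
  (x ≗ y)   overᶠ τ = ⊤
  (φ ∧ ψ)   overᶠ τ = φ overᶠ τ × ψ overᶠ τ
  ∃ᶠ x φ    overᶠ τ = φ overᶠ τ

  Assignment : Model 𝓢 ℓ → Set ℓ
  Assignment 𝔄 = Var → Domain 𝔄

  _[_↦_] : {A : Set ℓ} → (Var → A) → Var → A → (Var → A)
  (f [ x ↦ a ]) y = if does (y ≟ x) then a else f y

  _[_⇉_] : {A : Set ℓ} → (Var → A) → (xs : List Var) → Vec A (length xs) →
           (Var → A)
  f [ []     ⇉ []     ] = f
  f [ x ∷ xs ⇉ a ∷ as ] = (f [ xs ⇉ as ]) [ x ↦ a ]

  Sat : (𝔄 : Model 𝓢 ℓ) → Assignment 𝔄 →
        (φ : Formula 𝓢) → .(φ overᶠ vocabulary 𝔄) → Set ℓ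
  Sat 𝔄 f (atom R xs) o = Vec.map f xs ∈ interp 𝔄 R o
  Sat 𝔄 f (x ≗ y)     o = f x ≡ f y
  Sat 𝔄 f (φ ∧ ψ)     o = Sat 𝔄 f φ (proj₁ o) × Sat 𝔄 f ψ (proj₂ o)
  Sat 𝔄 f (∃ᶠ x φ)    o = ∃[ a ] Sat 𝔄 (f [ x ↦ a ]) φ o

  -- The j-th entry of the tuple is assigned to the j-th free variable.  The
  -- values at the other variables do not matter; an element of the domain is
  -- used there.
  ⟦_⟧ᶠ : (φ : Formula 𝓢) (𝔄 : Model 𝓢 ℓ) → .(φ overᶠ vocabulary 𝔄) →
         ADRel (Domain 𝔄)
  ⟦ φ ⟧ᶠ 𝔄 o = length (freeVars φ) ,
    λ as → Sat 𝔄 ((λ _ → nonempty 𝔄) [ freeVars φ ⇉ as ]) φ o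

module _ {𝓢 : RelationSymbols σ} where

  Equivalent : (ℓ : Level) → Formula 𝓢 → Term 𝓢 → Set (σ ⊔ lsuc ℓ)
  Equivalent ℓ φ T =
    (𝔄 : Model 𝓢 ℓ)
    .(φ-over : φ overᶠ vocabulary 𝔄) .(T-over : T overᵗ vocabulary 𝔄) →
    ⟦ φ ⟧ᶠ 𝔄 φ-over ≋ ⟦ T ⟧ᵗ 𝔄 T-over

  Equiexpressive : (ℓ : Level) → Pred (Term 𝓢) 0ℓ → Pred (Formula 𝓢) σ →
                   Set (σ ⊔ lsuc ℓ)
  Equiexpressive ℓ 𝒯 Φ =
    (∀ T → T ∈ 𝒯 → ∃[ φ ] (φ ∈ Φ × Equivalent ℓ φ T)) ×
    (∀ φ → φ ∈ Φ → ∃[ T ] (T ∈ 𝒯 × Equivalent ℓ φ T))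

{-# OPTIONS --safe #-}
module Submission where

-- Call a term T labelled by a list xs of variables a representation of φ if an
-- assignment f satisfies φ exactly when map f xs lies in T.  Atoms are labelled
-- by their own variables, J concatenates labels, ∃ removes a last label that
-- does not occur elsewhere, p rotates the labels and s swaps the last two, so
-- that all permutations are available, and I merges two adjacent equal labels.
-- Hence every representation can be relabelled by the sorted free variables.
--
-- Conversely, each term is the set of values of a repetition-free tuple of
-- variables under the assignments satisfying a conjunction of atoms that
-- mentions these variables: I renames one variable to another, J renames its
-- arguments apart, and the other operators act on the tuple only.  Renaming the
-- tuple to an increasing one and quantifying all other variables gives the query.

open import Data.List as List
  using (List; []; _∷_; _++_; [_]; length; map; filter; deduplicate; upTo;
         initLast; InitLast; _∷ʳ′_)
import Data.List.Membership.DecPropositional as DecMembership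
open import Data.List.Membership.Propositional using () renaming (_∈_ to _∈ˡ_; _∉_ to _∉ˡ_)
open import Data.List.Membership.Propositional.Properties
open import Data.List.Membership.Propositional.Properties.WithK using (unique∧set⇒bag)
import Data.List.Properties as List
open import Data.List.Relation.Binary.BagAndSetEquality using (∼bag⇒↭)
open import Data.List.Relation.Binary.Disjoint.Propositional using (Disjoint)
open import Data.List.Relation.Binary.Permutation.Propositional
  using (_↭_; refl; prep; swap; ↭-trans; ↭-sym; ↭⇒↭ₛ; module _↭_)
open import Data.List.Relation.Binary.Permutation.Propositional.Properties
  using (∈-resp-↭; shift; ++-comm; ↭-length)
import Data.List.Relation.Binary.Permutation.Setoid.Properties as ↭ₛ
open import Data.List.Relation.Binary.Pointwise using (Pointwise-≡⇒≡)
open import Data.List.Relation.Unary.All as All using ([]; _∷_)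
open import Data.List.Relation.Unary.AllPairs as AllPairs using (AllPairs; []; _∷_)
import Data.List.Relation.Unary.AllPairs.Properties as AllPairs
open import Data.List.Relation.Unary.Any using (here; there)
open import Data.List.Relation.Unary.Sorted.TotalOrder.Properties
  using (AllPairs⇒Sorted; ↗↭↗⇒≋)
open import Data.List.Relation.Unary.Unique.Propositional using (Unique)
import Data.List.Relation.Unary.Unique.Propositional.Properties as Unique
import Data.List.Relation.Unary.Unique.DecPropositional.Properties as DecUnique
open import Data.List.Reverse using (Reverse; reverseView; []; _∶_∶ʳ_)
open import Data.List.Sort using (sort; sort-↭; sort-↗)
open import Data.Nat using (ℕ; zero; suc; _+_; _<_; z<s; s<s; _≟_)
open import Data.Nat.Properties
  using (suc-injective; ≤-totalOrder; ≤-decTotalOrder; <⇒≤; <⇒≢)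
open import Data.Product as Product using (∃-syntax; _×_; _,_; proj₁; proj₂)
open import Data.Sum as Sum using (_⊎_; inj₁; inj₂; [_,_]′)
open import Data.Vec as Vec using (Vec; []; _∷_; toList)
import Data.Vec.Properties as Vec
open import Function using (_∘_; id; case_of_)
open import Function.Bundles using (_⇔_; mk⇔; Equivalence)
open import Level using (Level; 0ℓ; _⊔_) renaming (suc to lsuc)
open import Relation.Binary.PropositionalEquality
  using (_≡_; _≢_; refl; sym; trans; cong; cong₂; subst; setoid)
open import Relation.Nullary using (yes; no; ¬?; contradiction)
open import Relation.Nullary.Decidable using (dec-true; dec-false; decidable-stable)
open import Relation.Unary using (Pred; _∈_)
open import Defs

open Equivalence using (to; from)

private
  variable
    σ ℓ : Level
    A B : Set ℓ

-- AD-relations as sets of lists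

-- With lists in place of vectors, no tuple has to be transported along an
-- equation between arities.
_∋_ : ADRel {ℓ} A → List A → Set ℓ
(k , R) ∋ l = ∃[ t ] (toList {n = k} t ≡ l × R t)

toList-injective : ∀ {n} {t u : Vec A n} → toList t ≡ toList u → t ≡ u
toList-injective {t = t} {u} eq =
  trans (sym (Vec.cast-is-id refl t)) (Vec.toList-injective refl t u eq)

toList-surjective : ∀ {n} (l : List A) → length l ≡ n → ∃[ t ] toList {n = n} t ≡ l
toList-surjective l refl = Vec.fromList l , Vec.toList∘fromList l

∋-length : (R : ADRel A) {l : List A} → R ∋ l → length l ≡ proj₁ R
∋-length R (t , refl , _) = Vec.length-toList t

-- An empty relation contains no list that would reveal its arity, so the arities are compared
-- separately.
∋⇔⇒≋ : {R S : ADRel A} → proj₁ R ≡ proj₁ S → (∀ l → R ∋ l ⇔ S ∋ l) → R ≋ S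
∋⇔⇒≋ {R = k , R} {k , S} refl R⇔S =
  same ((λ {t} → transfer R S (λ l → to (R⇔S l)) t) ,
        (λ {t} → transfer S R (λ l → from (R⇔S l)) t))
  where
  transfer : ∀ R S → (∀ l → (k , R) ∋ l → (k , S) ∋ l) → ∀ t → R t → S t
  transfer R S R⇒S t r with u , eq , q ← R⇒S (toList t) (t , refl , r) =
    subst S (toList-injective eq) q

-- Rotating a list and swapping its last entries

rotate : List A → List A
rotate []      = []
rotate (a ∷ l) = l ++ [ a ]

rotate-injective : (l m : List A) → rotate l ≡ rotate m → l ≡ m
rotate-injective []      []      eq = refl
rotate-injective []      (b ∷ m) eq with () ← List.++-conicalʳ m [ b ] (sym eq)
rotate-injective (a ∷ l) []      eq with () ← List.++-conicalʳ l [ a ] eq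
rotate-injective (a ∷ l) (b ∷ m) eq with refl , refl ← List.∷ʳ-injective l m eq = refl

map-rotate : (f : A → B) (l : List A) → map f (rotate l) ≡ rotate (map f l)
map-rotate f []      = refl
map-rotate f (a ∷ l) = List.map-++ f l [ a ]

swapLast : List A → List A
swapLast []          = []
swapLast (a ∷ [])    = a ∷ []
swapLast (a ∷ b ∷ [])    = b ∷ a ∷ []
swapLast (a ∷ b ∷ c ∷ l) = a ∷ swapLast (b ∷ c ∷ l)

swapLast-++ : ∀ (l : List A) a b → swapLast (l ++ a ∷ b ∷ []) ≡ l ++ b ∷ a ∷ []
swapLast-++ []          a b = refl
swapLast-++ (c ∷ [])    a b = refl
swapLast-++ (c ∷ d ∷ []) a b = refl
swapLast-++ (c ∷ d ∷ d′ ∷ l) a b = cong (c ∷_) (swapLast-++ (d ∷ d′ ∷ l) a b)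

swapLast-involutive : (l : List A) → swapLast (swapLast l) ≡ l
swapLast-involutive l with initLast l
... | [] = refl
... | l′ ∷ʳ′ b with initLast l′
...   | [] = refl
...   | m ∷ʳ′ a rewrite List.++-assoc m [ a ] [ b ] =
        trans (cong swapLast (swapLast-++ m a b)) (swapLast-++ m b a)

map-swapLast : (f : A → B) (l : List A) → map f (swapLast l) ≡ swapLast (map f l)
map-swapLast f []          = refl
map-swapLast f (a ∷ [])    = refl
map-swapLast f (a ∷ b ∷ []) = refl
map-swapLast f (a ∷ b ∷ c ∷ l) = cong (f a ∷_) (map-swapLast f (b ∷ c ∷ l))

toList-∷ʳ∷ʳ : ∀ {n} (as : Vec A n) a b →
              toList (as Vec.∷ʳ a Vec.∷ʳ b) ≡ toList as ++ a ∷ b ∷ []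
toList-∷ʳ∷ʳ as a b =
  trans (Vec.toList-∷ʳ b (as Vec.∷ʳ a))
  (trans (cong (_++ [ b ]) (Vec.toList-∷ʳ a as)) (List.++-assoc (toList as) [ a ] [ b ]))

++-injective : ∀ (as bs : List A) {cs ds} → length as ≡ length bs →
               as ++ cs ≡ bs ++ ds → as ≡ bs × cs ≡ ds
++-injective []       []       _   eq = refl , eq
++-injective (a ∷ as) (b ∷ bs) len eq
  with refl , eq′ ← List.∷-injective eq
  with refl , eq″ ← ++-injective as bs (suc-injective len) eq′ = refl , eq″

length-∷ʳ : ∀ (l : List A) a → length (l ++ [ a ]) ≡ suc (length l)
length-∷ʳ []      a = refl
length-∷ʳ (_ ∷ l) a = cong suc (length-∷ʳ l a)

length-∷ʳ∷ʳ : ∀ (l : List A) a b → length (l ++ a ∷ b ∷ []) ≡ suc (suc (length l))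
length-∷ʳ∷ʳ []      a b = refl
length-∷ʳ∷ʳ (_ ∷ l) a b = cong suc (length-∷ʳ∷ʳ l a b)

length-rotate : (l : List A) → length (rotate l) ≡ length l
length-rotate []      = refl
length-rotate (a ∷ l) = length-∷ʳ l a

length-swapLast : (l : List A) → length (swapLast l) ≡ length l
length-swapLast []              = refl
length-swapLast (a ∷ [])        = refl
length-swapLast (a ∷ b ∷ [])    = refl
length-swapLast (a ∷ b ∷ c ∷ l) = cong suc (length-swapLast (b ∷ c ∷ l))

-- The operators in terms of lists

p-arity : (R : ADRel A) → proj₁ (pᴬ R) ≡ proj₁ R
p-arity (zero , _)        = refl
p-arity (suc zero , _)    = refl
p-arity (suc (suc _) , _) = refl

s-arity : (R : ADRel A) → proj₁ (sᴬ R) ≡ proj₁ R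
s-arity (zero , _)        = refl
s-arity (suc zero , _)    = refl
s-arity (suc (suc _) , _) = refl

-- `rotate` is the inverse of the cyclic shift made by `p`. It fixes lists of length at most one, so
-- the arities on which `p` is trivial fit the same description.
p-∋⁻ : ∀ (R : ADRel A) l → pᴬ R ∋ l → R ∋ rotate l
p-∋⁻ (zero , R)        _ ([] , refl , r)     = [] , refl , r
p-∋⁻ (suc zero , R)    _ (a ∷ [] , refl , r) = a ∷ [] , refl , r
p-∋⁻ (suc (suc k) , R) _ (_ , refl , as , a , refl , r) =
  as Vec.∷ʳ a , Vec.toList-∷ʳ a as , r

p-∋⁺ : ∀ (R : ADRel A) l → R ∋ rotate l → pᴬ R ∋ l
p-∋⁺ (zero , R)        l ([] , eq , r)     = [] , rotate-injective [] l eq , r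
p-∋⁺ (suc zero , R)    l (a ∷ [] , eq , r) = a ∷ [] , rotate-injective (a ∷ []) l eq , r
p-∋⁺ (suc (suc k) , R) l (t , eq , r) with as , b , refl ← Vec.initLast t =
  b ∷ as , rotate-injective _ l (trans (sym (Vec.toList-∷ʳ b as)) eq) , as , b , refl , r

s-∋⁻ : ∀ (R : ADRel A) l → sᴬ R ∋ l → R ∋ swapLast l
s-∋⁻ (zero , R)        _ ([] , refl , r)     = [] , refl , r
s-∋⁻ (suc zero , R)    _ (a ∷ [] , refl , r) = a ∷ [] , refl , r
s-∋⁻ (suc (suc k) , R) _ (_ , refl , as , a , b , refl , r) =
  as Vec.∷ʳ a Vec.∷ʳ b ,
  trans (toList-∷ʳ∷ʳ as a b)
    (sym (trans (cong swapLast (toList-∷ʳ∷ʳ as b a)) (swapLast-++ (toList as) b a))) ,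
  r

s-∋⁺ : ∀ (R : ADRel A) l → R ∋ swapLast l → sᴬ R ∋ l
-- Since `swapLast` is an involution, `l` is `swapLast (toList t)` and can be eliminated by matching
-- on the equation.
s-∋⁺ R l (t , eq , r) = lemma R l t (trans (cong swapLast eq) (swapLast-involutive l)) r
  where
  lemma : ∀ (R : ADRel _) l t → swapLast (toList t) ≡ l → proj₂ R t → sᴬ R ∋ l
  lemma (zero , R)        _ []       refl r = [] , refl , r
  lemma (suc zero , R)    _ (a ∷ []) refl r = a ∷ [] , refl , r
  lemma (suc (suc k) , R) _ t        refl r
    with as′ , b , refl ← Vec.initLast t
    with as , a , refl ← Vec.initLast as′
    = as Vec.∷ʳ b Vec.∷ʳ a ,
      trans (toList-∷ʳ∷ʳ as b a)
        (sym (trans (cong swapLast (toList-∷ʳ∷ʳ as a b)) (swapLast-++ (toList as) a b))) ,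
      as , a , b , refl , r

-- The arity of an interpreted term is known only up to a propositional equation. Taking that
-- equation as an argument lets `Iᴬ` compute once it is matched with `refl`; the lemmas on `∃ᴬ` do
-- the same.
I-arity : ∀ (R : ADRel A) {n} → proj₁ R ≡ suc (suc n) → proj₁ (Iᴬ R) ≡ suc n
I-arity _ refl = refl

I-trivial : (R : ADRel A) → proj₁ R < 2 → Iᴬ R ≡ R
I-trivial (zero , _)        _              = refl
I-trivial (suc zero , _)    _              = refl
I-trivial (suc (suc _) , _) (s<s (s<s ()))

I-∋⁻ : ∀ (R : ADRel A) {n} → proj₁ R ≡ suc (suc n) → ∀ {l} → Iᴬ R ∋ l →
       ∃[ m ] ∃[ a ] (l ≡ m ++ [ a ] × R ∋ (m ++ a ∷ a ∷ []))
I-∋⁻ _ refl (_ , refl , as , a , _ , refl , r , refl) =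
  toList as , a , Vec.toList-∷ʳ a as , as Vec.∷ʳ a Vec.∷ʳ a , toList-∷ʳ∷ʳ as a a , r

∷ʳ∷ʳ-injective : ∀ (l m : List A) {a b c d} →
                 l ++ a ∷ b ∷ [] ≡ m ++ c ∷ d ∷ [] → l ≡ m × a ≡ c × b ≡ d
∷ʳ∷ʳ-injective l m {a} {b} {c} {d} eq
  with eq′ , b≡d ← List.∷ʳ-injective (l ++ [ a ]) (m ++ [ c ])
         (trans (List.++-assoc l [ a ] [ b ]) (trans eq (sym (List.++-assoc m [ c ] [ d ]))))
  with l≡m , a≡c ← List.∷ʳ-injective l m eq′ = l≡m , a≡c , b≡d

I-∋⁺ : ∀ (R : ADRel A) {n} → proj₁ R ≡ suc (suc n) → ∀ m a →
       R ∋ (m ++ a ∷ a ∷ []) → Iᴬ R ∋ (m ++ [ a ])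
I-∋⁺ (_ , R) refl m a (t , eq , r)
  with as′ , b , refl ← Vec.initLast t
  with as , c , refl ← Vec.initLast as′
  with refl , refl , refl ← ∷ʳ∷ʳ-injective (toList as) m (trans (sym (toList-∷ʳ∷ʳ as c b)) eq)
  = as Vec.∷ʳ c , Vec.toList-∷ʳ c as , as , c , c , refl , r , refl

∃-arity : ∀ (R : ADRel A) {n} → proj₁ R ≡ suc n → proj₁ (∃ᴬ R) ≡ n
∃-arity _ refl = refl

∃-trivial : (R : ADRel A) → proj₁ R ≡ 0 → ∃ᴬ R ≡ R
∃-trivial _ refl = refl

∃-∋ : ∀ (R : ADRel A) {n} → proj₁ R ≡ suc n → ∀ l →
      ∃ᴬ R ∋ l ⇔ (∃[ a ] R ∋ (l ++ [ a ]))
∃-∋ (_ , R) refl l = mk⇔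
  (λ where (as , refl , a , r) → a , as Vec.∷ʳ a , Vec.toList-∷ʳ a as , r)
  (λ where (a , t , eq , r) → ⁺ a t eq r)
  where
  ⁺ : ∀ a t → toList t ≡ l ++ [ a ] → R t → ∃ᴬ (_ , R) ∋ l
  ⁺ a t eq r with as , b , refl ← Vec.initLast t
    with refl , refl ← List.∷ʳ-injective (toList as) l (trans (sym (Vec.toList-∷ʳ b as)) eq)
    = as , refl , b , r

J-∋⁻ : ∀ (R S : ADRel A) {l} → Jᴬ R S ∋ l → ∃[ m ] ∃[ n ] (l ≡ m ++ n × R ∋ m × S ∋ n)
J-∋⁻ R S (_ , refl , as , bs , refl , r , q) =
  toList as , toList bs , Vec.toList-++ as bs , (as , refl , r) , (bs , refl , q)

J-∋⁺ : ∀ (R S : ADRel A) {m n} → R ∋ m → S ∋ n → Jᴬ R S ∋ (m ++ n)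
J-∋⁺ R S (as , refl , r) (bs , refl , q) =
  as Vec.++ bs , Vec.toList-++ as bs , as , bs , refl , r , q

-- Lists of variables

open DecMembership _≟_ using () renaming (_∈?_ to _∈ˡ?_)

map-cong-∈ : ∀ {f g : A → B} {xs} → (∀ {z} → z ∈ˡ xs → f z ≡ g z) → map f xs ≡ map g xs
map-cong-∈ f≡g = List.map-cong-local (All.tabulate f≡g)

unique∧set⇒↭ : {xs ys : List A} → Unique xs → Unique ys →
               (∀ {z} → z ∈ˡ xs ⇔ z ∈ˡ ys) → xs ↭ ys
unique∧set⇒↭ xs! ys! xs⇔ys = ∼bag⇒↭ (unique∧set⇒bag xs! ys! xs⇔ys)

Unique-resp-↭ : {xs ys : List A} → xs ↭ ys → Unique xs → Unique ys
Unique-resp-↭ xs↭ys = ↭ₛ.Unique-resp-↭ (setoid _) (↭⇒↭ₛ xs↭ys)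

module _ {𝓢 : RelationSymbols σ} (φ : Formula 𝓢) where

  ∈-freeVars : ∀ {z} → z ∈ˡ freeVars φ ⇔ z ∈ˡ freeOccurrences φ
  ∈-freeVars = mk⇔
    (∈-deduplicate⁻ _≟_ _ ∘ ∈-resp-↭ (sort-↭ ≤-decTotalOrder _))
    (∈-resp-↭ (↭-sym (sort-↭ ≤-decTotalOrder _)) ∘ ∈-deduplicate⁺ _≟_)

  freeVars-! : Unique (freeVars φ)
  freeVars-! = Unique-resp-↭ (↭-sym (sort-↭ ≤-decTotalOrder _))
                             (DecUnique.deduplicate-! _≟_ (freeOccurrences φ))

  -- Repetition-free lists with the same members are permutations of each other, and sorted
  -- permutations of each other coincide.
  freeVars-unique : ∀ {zs} → AllPairs _<_ zs →
                    (∀ {z} → z ∈ˡ freeOccurrences φ ⇔ z ∈ˡ zs) → freeVars φ ≡ zs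
  freeVars-unique zs< occ⇔zs = Pointwise-≡⇒≡ (↗↭↗⇒≋ ≤-totalOrder
    (sort-↗ ≤-decTotalOrder _)
    (AllPairs⇒Sorted ≤-totalOrder (AllPairs.map <⇒≤ zs<))
    (↭⇒↭ₛ (unique∧set⇒↭ freeVars-! (AllPairs.map <⇒≢ zs<)
      (mk⇔ (to occ⇔zs ∘ to ∈-freeVars) (from ∈-freeVars ∘ from occ⇔zs)))))

-- Assignments

module _ {𝓢 : RelationSymbols σ} where

  -- The mixfix notation depends on `𝓢`, which its arguments do not determine; `update` and `assign`
  -- fix it.
  update : (Var → A) → Var → A → (Var → A)
  update = _[_↦_] {𝓢 = 𝓢}

  assign : (Var → A) → (xs : List Var) → Vec A (length xs) → (Var → A)
  assign = _[_⇉_] {𝓢 = 𝓢}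

  update-≡ : ∀ (f : Var → A) x a → update f x a x ≡ a
  update-≡ f x a rewrite dec-true (x ≟ x) refl = refl

  update-≢ : ∀ (f : Var → A) {x} a {y} → y ≢ x → update f x a y ≡ f y
  update-≢ f {x} a {y} y≢x rewrite dec-false (y ≟ x) y≢x = refl

  update-cong : ∀ (f g : Var → A) x a {y} → (y ≢ x → f y ≡ g y) →
                update f x a y ≡ update g x a y
  update-cong f g x a {y} f≡g with y ≟ x
  ... | yes refl = trans (update-≡ f x a) (sym (update-≡ g x a))
  ... | no y≢x   = trans (update-≢ f a y≢x) (trans (f≡g y≢x) (sym (update-≢ g a y≢x)))

  update-self : ∀ (f : Var → A) x y → update f x (f x) y ≡ f y
  update-self f x y with y ≟ x
  ... | yes refl = update-≡ f x (f x)
  ... | no y≢x   = update-≢ f (f x) y≢x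

  -- The update at the first variable is the outermost one; by uniqueness it does not disturb the
  -- values at the later variables.
  map-assign : ∀ (f : Var → A) {xs} → Unique xs → ∀ as → map (assign f xs as) xs ≡ toList as
  map-assign f []         []       = refl
  map-assign f {x ∷ xs} (x∉xs ∷ xs!) (a ∷ as) = cong₂ _∷_ (update-≡ f′ x a)
    (trans (map-cong-∈ λ z∈xs → update-≢ f′ a λ z≡x → All.lookup x∉xs z∈xs (sym z≡x))
           (map-assign f xs! as))
    where f′ = assign f xs as

  -- Allows a tuple of a relation to be read as the values of an assignment. The element `a`, which
  -- a nonempty domain supplies, is the value outside `xs`.
  interpolate : ∀ {xs} → A → Unique xs → (l : List A) → length l ≡ length xs →
                ∃[ f ] map f xs ≡ l
  interpolate {xs = xs} a xs! l len with as , eq ← toList-surjective l len =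
    assign (λ _ → a) xs as , trans (map-assign (λ _ → a) xs! as) eq

  assign-map : ∀ (f g : Var → A) xs as → toList as ≡ map g xs →
               ∀ {z} → z ∈ˡ xs → assign f xs as z ≡ g z
  assign-map f g (x ∷ xs) (a ∷ as) eq {z} z∈ with z ≟ x | List.∷-injective eq | z∈
  ... | yes refl | refl , _   | _          = update-≡ (assign f xs as) x a
  ... | no z≢x   | _    , _   | here z≡x   = contradiction z≡x z≢x
  ... | no z≢x   | _    , eq′ | there z∈xs =
    trans (update-≢ (assign f xs as) a z≢x) (assign-map f g xs as eq′ z∈xs)

  module _ (𝔄 : Model 𝓢 ℓ) where

    -- The coincidence lemma. Under a quantifier both assignments receive the same value at `x`, so
    -- they need to agree only at the occurrences that survive the filter.
    Sat-cong : ∀ φ .(o : φ overᶠ vocabulary 𝔄) {f g} →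
               (∀ {z} → z ∈ˡ freeOccurrences φ → f z ≡ g z) → Sat 𝔄 f φ o → Sat 𝔄 g φ o
    Sat-cong (atom R xs) o {f} {g} f≡g = subst (λ t → interp 𝔄 R o t)
      (toList-injective (trans (Vec.toList-map f xs)
        (trans (map-cong-∈ f≡g) (sym (Vec.toList-map g xs)))))
    Sat-cong (x ≗ y) o f≡g fx≡fy =
      trans (sym (f≡g (here refl))) (trans fx≡fy (f≡g (there (here refl))))
    Sat-cong (φ ∧ ψ) o f≡g (sφ , sψ) =
      Sat-cong φ _ (f≡g ∘ ∈-++⁺ˡ) sφ ,
      Sat-cong ψ _ (f≡g ∘ ∈-++⁺ʳ (freeOccurrences φ)) sψ
    Sat-cong (∃ᶠ x φ) o {f} {g} f≡g (a , sφ) = a , Sat-cong φ o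
      (λ z∈φ → update-cong f g x a λ z≢x → f≡g (∈-filter⁺ (λ y → ¬? (y ≟ x)) z∈φ z≢x)) sφ

    -- Replaces the default assignment of the definition by an arbitrary one; by coincidence only
    -- the values at the free variables matter.
    ⟦⟧ᶠ-∋ : ∀ φ .(o : φ overᶠ vocabulary 𝔄) l →
            ⟦ φ ⟧ᶠ 𝔄 o ∋ l ⇔ (∃[ f ] (Sat 𝔄 f φ o × map f (freeVars φ) ≡ l))
    ⟦⟧ᶠ-∋ φ o l = mk⇔
      (λ where (as , refl , sφ) → assign (λ _ → nonempty 𝔄) (freeVars φ) as , sφ ,
                                  map-assign (λ _ → nonempty 𝔄) (freeVars-! φ) as)
      (λ where
        (f , sφ , refl) → let as , eq = toList-surjective _ (List.length-map f (freeVars φ)) in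
          as , eq , Sat-cong φ o
            (λ z∈φ → sym (assign-map (λ _ → nonempty 𝔄) f _ as eq (from (∈-freeVars φ) z∈φ))) sφ)

-- Abstracts over the two pairs (term algebra, admissible atoms), so that the
-- equiexpressivity proof is given only once.
record Fragment {𝓢 : RelationSymbols σ} (𝒯 : Pred (Term 𝓢) 0ℓ)
                (𝒜 : Pred (Formula 𝓢) σ) : Set σ where
  field
    rel∈   : ∀ R → rel R ∈ 𝒯
    p⇔     : ∀ {T} → p T ∈ 𝒯 ⇔ T ∈ 𝒯
    s⇔     : ∀ {T} → s T ∈ 𝒯 ⇔ T ∈ 𝒯
    I⇔     : ∀ {T} → I T ∈ 𝒯 ⇔ T ∈ 𝒯
    J⇔     : ∀ {T T′} → J T T′ ∈ 𝒯 ⇔ (T ∈ 𝒯 × T′ ∈ 𝒯)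
    ∃⇔     : ∀ {T} → ∃ᵗ T ∈ 𝒯 ⇔ T ∈ 𝒯
    atom∈  : ∀ R xs → atom R xs ∈ 𝒜
    ≗⇔     : ∀ {x y} → (x ≗ y) ∈ 𝒜 ⇔ e ∈ 𝒯
    atomic : ∀ {φ} → φ ∈ 𝒜 → RelationOrEqualityAtom φ

-- From queries to terms

∈⇒↭∷ : {x : A} {xs : List A} → x ∈ˡ xs → ∃[ zs ] xs ↭ x ∷ zs
∈⇒↭∷ x∈xs with ys , zs , refl ← ∈-∃++ x∈xs = ys ++ zs , shift _ ys zs

∈-∷⁻ : {x y : A} {xs : List A} → x ≢ y → y ∈ˡ x ∷ xs → y ∈ˡ xs
∈-∷⁻ x≢y (here y≡x) = contradiction (sym y≡x) x≢y
∈-∷⁻ _   (there y∈) = y∈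

-- The entries of `ys` are extracted from `xs` one by one; as they are distinct, removing one leaves
-- the others available. What remains is the surplus `zs`.
⊆⇒↭++ : {xs ys : List A} → Unique ys → (∀ {z} → z ∈ˡ ys → z ∈ˡ xs) →
        ∃[ zs ] xs ↭ zs ++ ys
⊆⇒↭++ {xs = xs} [] ys⊆xs = xs , subst (xs ↭_) (sym (List.++-identityʳ xs)) refl
⊆⇒↭++ {ys = y ∷ ys} (y∉ys ∷ ys!) ys⊆xs
  with ws , xs↭y∷ws ← ∈⇒↭∷ (ys⊆xs (here refl))
  with zs , ws↭zs++ys ← ⊆⇒↭++ {xs = ws} ys! (λ z∈ys →
         ∈-∷⁻ (All.lookup y∉ys z∈ys) (∈-resp-↭ xs↭y∷ws (ys⊆xs (there z∈ys))))
  = zs , ↭-trans xs↭y∷ws (↭-trans (prep y ws↭zs++ys) (↭-sym (shift y zs ys)))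

module _ {𝓢 : RelationSymbols σ} (ℓ : Level) where

  -- The label may contain repetitions, as the arguments of an atom do. For an empty relation `Sat⇔`
  -- does not determine the arity, hence the field `arity≡`.
  record Represents (T : Term 𝓢) (xs : List Var) (φ : Formula 𝓢) : Set (σ ⊔ lsuc ℓ) where
    field
      arity≡ : (𝔄 : Model 𝓢 ℓ) .(o : T overᵗ vocabulary 𝔄) →
               proj₁ (⟦ T ⟧ᵗ 𝔄 o) ≡ length xs
      Sat⇔   : (𝔄 : Model 𝓢 ℓ) .(oφ : φ overᶠ vocabulary 𝔄) .(o : T overᵗ vocabulary 𝔄) →
               ∀ f → Sat 𝔄 f φ oφ ⇔ ⟦ T ⟧ᵗ 𝔄 o ∋ map f xs

  open Represents

  -- The free variables are listed without repetition, so every tuple of `T` is their value under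
  -- some assignment, to which `Sat⇔` applies.
  represents⇒Equivalent : ∀ {T φ} → Represents T (freeVars φ) φ → Equivalent ℓ φ T
  represents⇒Equivalent {T} {φ} T∼φ 𝔄 oφ o = ∋⇔⇒≋ (sym (arity≡ T∼φ 𝔄 o)) λ l → mk⇔
    (λ φ∋l → case (to (⟦⟧ᶠ-∋ 𝔄 φ oφ l) φ∋l) of λ where
      (f , sφ , refl) → to (Sat⇔ T∼φ 𝔄 oφ o f) sφ)
    (λ T∋l → let
        f , f≡l = interpolate {𝓢 = 𝓢} (nonempty 𝔄) (freeVars-! φ) l
                    (trans (∋-length (⟦ T ⟧ᵗ 𝔄 o) T∋l) (arity≡ T∼φ 𝔄 o))
      in from (⟦⟧ᶠ-∋ 𝔄 φ oφ l)
        (f , from (Sat⇔ T∼φ 𝔄 oφ o f) (subst (⟦ T ⟧ᵗ 𝔄 o ∋_) (sym f≡l) T∋l) , f≡l))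

  module _ {𝒯 𝒜} (fragment : Fragment {𝓢 = 𝓢} 𝒯 𝒜) where

    open Fragment fragment

    Representable : List Var → Formula 𝓢 → Set (σ ⊔ lsuc ℓ)
    Representable xs φ = ∃[ T ] (T ∈ 𝒯 × Represents T xs φ)

    -- Effect of the operators on labels

    atomʳ : ∀ R xs → Representable (toList xs) (atom R xs)
    atomʳ R xs = rel R , rel∈ R , record
      { arity≡ = λ _ _ → sym (Vec.length-toList xs)
      ; Sat⇔   = λ 𝔄 oφ o f → mk⇔ {B = ⟦ rel R ⟧ᵗ 𝔄 o ∋ map f (toList xs)}
          (λ r → Vec.map f xs , Vec.toList-map f xs , r)
          λ where (t , eq , r) → subst (λ t → interp 𝔄 R o t)
                    (toList-injective (trans eq (sym (Vec.toList-map f xs)))) r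
      }

    ≗ʳ : ∀ x y → e ∈ 𝒯 → Representable (x ∷ y ∷ []) (x ≗ y)
    ≗ʳ x y e∈ = e , e∈ , record
      { arity≡ = λ _ _ → refl
      ; Sat⇔   = λ 𝔄 oφ o f → mk⇔
          (λ fx≡fy → f x ∷ f y ∷ [] , refl , f x , cong (λ a → f x ∷ a ∷ []) (sym fx≡fy))
          λ where (a ∷ _ ∷ [] , eq , _ , refl) → trans (sym (List.∷-injectiveˡ eq))
                    (List.∷-injectiveˡ (List.∷-injectiveʳ eq))
      }

    ∧ʳ : ∀ {xs ys φ ψ} → Representable xs φ → Representable ys ψ →
         Representable (xs ++ ys) (φ ∧ ψ)
    ∧ʳ {xs} {ys} {φ} {ψ} (T , T∈ , T∼φ) (T′ , T′∈ , T′∼ψ) = J T T′ , from J⇔ (T∈ , T′∈) , record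
      { arity≡ = λ 𝔄 o → trans (cong₂ _+_ (arity≡ T∼φ 𝔄 (proj₁ o)) (arity≡ T′∼ψ 𝔄 (proj₂ o)))
                               (sym (List.length-++ xs))
      ; Sat⇔   = λ 𝔄 oφ o f →
          let R = ⟦ T ⟧ᵗ 𝔄 (proj₁ o); S = ⟦ T′ ⟧ᵗ 𝔄 (proj₂ o)
              φ⇔T = Sat⇔ T∼φ 𝔄 (proj₁ oφ) (proj₁ o) f; ψ⇔T′ = Sat⇔ T′∼ψ 𝔄 (proj₂ oφ) (proj₂ o) f
          in mk⇔
          (λ (sφ , sψ) → subst (Jᴬ R S ∋_) (sym (List.map-++ f xs ys))
            (J-∋⁺ R S (to φ⇔T sφ) (to ψ⇔T′ sψ)))
          (λ J∋ → case (J-∋⁻ R S J∋) of λ where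
            -- Both prefixes have the arity of `T` as their length, so the tuple is split where the
            -- label is.
            (m , n , eq , r , q) → case (++-injective (map f xs) m
                (trans (List.length-map f xs)
                  (trans (sym (arity≡ T∼φ 𝔄 (proj₁ o))) (sym (∋-length R r))))
                (trans (sym (List.map-++ f xs ys)) eq)) of λ where
              (refl , refl) → from φ⇔T r , from ψ⇔T′ q)
      }

    -- `p` moves the last entry of a tuple to the front and thereby undoes `rotate` on the label.
    rotateʳ : ∀ {φ} xs → Representable (rotate xs) φ → Representable xs φ
    rotateʳ xs (T , T∈ , T∼φ) = p T , from p⇔ T∈ , record
      { arity≡ = λ 𝔄 o → trans (p-arity (⟦ T ⟧ᵗ 𝔄 o)) (trans (arity≡ T∼φ 𝔄 o) (length-rotate xs))
      ; Sat⇔   = λ 𝔄 oφ o f → let R = ⟦ T ⟧ᵗ 𝔄 o; φ⇔T = Sat⇔ T∼φ 𝔄 oφ o f in mk⇔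
          (p-∋⁺ R _ ∘ subst (R ∋_) (map-rotate f xs) ∘ to φ⇔T)
          (from φ⇔T ∘ subst (R ∋_) (sym (map-rotate f xs)) ∘ p-∋⁻ R _)
      }

    swapLastʳ : ∀ {φ} xs → Representable (swapLast xs) φ → Representable xs φ
    swapLastʳ xs (T , T∈ , T∼φ) = s T , from s⇔ T∈ , record
      { arity≡ = λ 𝔄 o → trans (s-arity (⟦ T ⟧ᵗ 𝔄 o)) (trans (arity≡ T∼φ 𝔄 o) (length-swapLast xs))
      ; Sat⇔   = λ 𝔄 oφ o f → let R = ⟦ T ⟧ᵗ 𝔄 o; φ⇔T = Sat⇔ T∼φ 𝔄 oφ o f in mk⇔
          (s-∋⁺ R _ ∘ subst (R ∋_) (map-swapLast f xs) ∘ to φ⇔T)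
          (from φ⇔T ∘ subst (R ∋_) (sym (map-swapLast f xs)) ∘ s-∋⁻ R _)
      }

    -- Equal labels receive equal values under every assignment, so the equality that `I` demands
    -- always holds for the tuples in question.
    mergeʳ : ∀ {φ} xs x → Representable (xs ++ x ∷ x ∷ []) φ → Representable (xs ++ [ x ]) φ
    mergeʳ xs x (T , T∈ , T∼φ) = I T , from I⇔ T∈ , record
      { arity≡ = λ 𝔄 o → trans (I-arity (⟦ T ⟧ᵗ 𝔄 o) (arityᵀ 𝔄 o)) (sym (length-∷ʳ xs x))
      ; Sat⇔   = λ 𝔄 oφ o f → let R = ⟦ T ⟧ᵗ 𝔄 o; φ⇔T = Sat⇔ T∼φ 𝔄 oφ o f in mk⇔
          (λ sφ → subst (Iᴬ R ∋_) (sym (List.map-++ f xs [ x ]))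
            (I-∋⁺ R (arityᵀ 𝔄 o) (map f xs) (f x)
              (subst (R ∋_) (List.map-++ f xs (x ∷ x ∷ [])) (to φ⇔T sφ))))
          (λ I∋ → case (I-∋⁻ R (arityᵀ 𝔄 o) I∋) of λ where
            (m , a , eq , r) → case (List.∷ʳ-injective (map f xs) m
                (trans (sym (List.map-++ f xs [ x ])) eq)) of λ where
              (refl , refl) →
                from φ⇔T (subst (R ∋_) (sym (List.map-++ f xs (x ∷ x ∷ []))) r))
      }
      where
      arityᵀ : ∀ 𝔄 .o → proj₁ (⟦ T ⟧ᵗ 𝔄 o) ≡ suc (suc (length xs))
      arityᵀ 𝔄 o = trans (arity≡ T∼φ 𝔄 o) (length-∷ʳ∷ʳ xs x x)

    -- As `x` does not occur in `xs`, changing the value at `x` affects the last entry alone, which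
    -- is the one that `∃ᵗ` projects away.
    ∃ʳ : ∀ {φ} xs x → x ∉ˡ xs → Representable (xs ++ [ x ]) φ → Representable xs (∃ᶠ x φ)
    ∃ʳ xs x x∉xs (T , T∈ , T∼φ) = ∃ᵗ T , from ∃⇔ T∈ , record
      { arity≡ = λ 𝔄 o → ∃-arity (⟦ T ⟧ᵗ 𝔄 o) (arityᵀ 𝔄 o)
      ; Sat⇔   = λ 𝔄 oφ o f → let R = ⟦ T ⟧ᵗ 𝔄 o; ∃⇔R = ∃-∋ R (arityᵀ 𝔄 o) (map f xs) in mk⇔
          (λ (a , sφ) → from ∃⇔R
            (a , subst (R ∋_) (map-update f a) (to (Sat⇔ T∼φ 𝔄 oφ o _) sφ)))
          (λ ∃∋ → let a , r = to ∃⇔R ∃∋ in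
            a , from (Sat⇔ T∼φ 𝔄 oφ o _) (subst (R ∋_) (sym (map-update f a)) r))
      }
      where
      arityᵀ : ∀ 𝔄 .o → proj₁ (⟦ T ⟧ᵗ 𝔄 o) ≡ suc (length xs)
      arityᵀ 𝔄 o = trans (arity≡ T∼φ 𝔄 o) (length-∷ʳ xs x)

      map-update : ∀ {A : Set ℓ} (f : Var → A) a →
                   map (update {𝓢 = 𝓢} f x a) (xs ++ [ x ]) ≡ map f xs ++ [ a ]
      map-update f a = trans (List.map-++ _ xs [ x ]) (cong₂ (λ l b → l ++ [ b ])
        (map-cong-∈ λ z∈xs → update-≢ {𝓢 = 𝓢} f a λ where refl → x∉xs z∈xs)
        (update-≡ {𝓢 = 𝓢} f x a))

    -- A vacuous quantifier needs no operator, because domains are nonempty.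
    vacuous-∃ʳ : ∀ {φ} xs x → x ∉ˡ xs → Representable xs φ → Representable xs (∃ᶠ x φ)
    vacuous-∃ʳ xs x x∉xs (T , T∈ , T∼φ) = T , T∈ , record
      { arity≡ = arity≡ T∼φ
      ; Sat⇔   = λ 𝔄 oφ o f → let R = ⟦ T ⟧ᵗ 𝔄 o in mk⇔
          (λ (a , sφ) → subst (R ∋_) (map-update f a) (to (Sat⇔ T∼φ 𝔄 oφ o _) sφ))
          (λ T∋ → nonempty 𝔄 , from (Sat⇔ T∼φ 𝔄 oφ o _)
            (subst (R ∋_) (sym (map-update f (nonempty 𝔄))) T∋))
      }
      where
      map-update : ∀ {A : Set ℓ} (f : Var → A) a → map (update {𝓢 = 𝓢} f x a) xs ≡ map f xs
      map-update f a =
        map-cong-∈ λ z∈xs → update-≢ {𝓢 = 𝓢} f a λ where refl → x∉xs z∈xs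

    -- Rearranging labels

    ++-commʳ : ∀ {φ} xs ys → Representable (xs ++ ys) φ → Representable (ys ++ xs) φ
    ++-commʳ {φ} xs ys = go xs (reverseView ys)
      where
      go : ∀ xs {ys} → Reverse ys → Representable (xs ++ ys) φ → Representable (ys ++ xs) φ
      go xs [] = subst (λ l → Representable l φ) (List.++-identityʳ xs)
      -- One `p` brings the last label to the front, so `ys` is consumed from its end.
      go xs (ys ∶ rs ∶ʳ y) r = subst (λ l → Representable l φ) (sym (List.++-assoc ys [ y ] xs))
        (go (y ∷ xs) rs (rotateʳ (y ∷ xs ++ ys)
          (subst (λ l → Representable l φ) (sym (List.++-assoc xs ys [ y ])) r)))

    -- Adjacent transpositions generate all permutations. The prefix `zs` holds the labels that are
    -- already in place.
    permuteʳ : ∀ {φ xs ys} → xs ↭ ys → Representable xs φ → Representable ys φ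
    permuteʳ {φ} = go []
      where
      go : ∀ zs {xs ys} → xs ↭ ys → Representable (zs ++ xs) φ → Representable (zs ++ ys) φ
      go zs refl r = r
      go zs (prep {xs = xs} {ys} x xs↭ys) r =
        subst (λ l → Representable l φ) (List.++-assoc zs [ x ] ys)
          (go (zs ++ [ x ]) xs↭ys
            (subst (λ l → Representable l φ) (sym (List.++-assoc zs [ x ] xs)) r))
      -- `s` reaches only the end of a label. From the inside out: `xs` goes to the front, the now
      -- last labels `x` and `y` are swapped, and `xs` returns to the back before the recursive
      -- call.
      go zs (swap {xs = xs} {ys} x y xs↭ys) r =
        subst (λ l → Representable l φ) (List.++-assoc zs (y ∷ x ∷ []) ys)
          (go (zs ++ y ∷ x ∷ []) xs↭ys
            (++-commʳ xs (zs ++ y ∷ x ∷ [])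
            (subst (λ l → Representable l φ) (List.++-assoc xs zs _)
            (swapLastʳ ((xs ++ zs) ++ y ∷ x ∷ [])
            (subst (λ l → Representable l φ)
              (trans (sym (List.++-assoc xs zs _)) (sym (swapLast-++ (xs ++ zs) y x)))
            (++-commʳ (zs ++ x ∷ y ∷ []) xs
            (subst (λ l → Representable l φ) (sym (List.++-assoc zs (x ∷ y ∷ []) xs)) r)))))))
      go zs (_↭_.trans xs↭ws ws↭ys) r = go zs ws↭ys (go zs xs↭ws r)

    -- The label `x` occurs once more further on, in `ys`. A permutation brings both copies to the
    -- end, where `I` merges them, and another one restores the order.
    absorbʳ : ∀ {φ} xs ys → (∀ {z} → z ∈ˡ xs → z ∈ˡ ys) →
              Representable (xs ++ ys) φ → Representable ys φ
    absorbʳ []       ys _     r = r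
    absorbʳ (x ∷ xs) ys xs⊆ys r
      with zs , ↭x∷zs ← ∈⇒↭∷ (∈-++⁺ʳ xs (xs⊆ys (here refl)))
      = absorbʳ xs ys (xs⊆ys ∘ there)
          (permuteʳ (↭-trans (++-comm zs [ x ]) (↭-sym ↭x∷zs))
          (mergeʳ zs x
          (permuteʳ (↭-trans (prep x ↭x∷zs) (++-comm (x ∷ x ∷ []) zs)) r)))

    -- Up to order, `xs` consists of `ys` and surplus labels, each of which repeats a label of `ys`
    -- and can be absorbed.
    normaliseʳ : ∀ {φ xs ys} → Unique ys → (∀ {z} → z ∈ˡ xs ⇔ z ∈ˡ ys) →
                 Representable xs φ → Representable ys φ
    normaliseʳ ys! xs⇔ys r with zs , xs↭zs++ys ← ⊆⇒↭++ ys! (from xs⇔ys) =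
      absorbʳ zs _ (to xs⇔ys ∘ ∈-resp-↭ (↭-sym xs↭zs++ys) ∘ ∈-++⁺ˡ) (permuteʳ xs↭zs++ys r)

    -- Representing queries by induction

    atomic-representable : ∀ {φ} → φ ∈ 𝒜 → Representable (freeVars φ) φ
    atomic-representable {φ} φ∈ = normaliseʳ (freeVars-! φ)
      (mk⇔ (from (∈-freeVars φ)) (to (∈-freeVars φ))) (go φ∈ (atomic φ∈))
      where
      go : ∀ {φ} → φ ∈ 𝒜 → RelationOrEqualityAtom φ → Representable (freeOccurrences φ) φ
      go φ∈ (atom R xs) = atomʳ R xs
      go φ∈ (x ≗ y)     = ≗ʳ x y (to ≗⇔ φ∈)

    conjunction-representable : ∀ {φ} → ConjunctionOf 𝒜 φ → Representable (freeVars φ) φ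
    conjunction-representable (single φ∈) = atomic-representable φ∈
    conjunction-representable (_∧_ {φ} {ψ} c d) = normaliseʳ (freeVars-! (φ ∧ ψ))
      (mk⇔ (from (∈-freeVars (φ ∧ ψ)) ∘ ∈-++⁺ ∘ Sum.map (to (∈-freeVars φ)) (to (∈-freeVars ψ))
              ∘ ∈-++⁻ (freeVars φ))
           (∈-++⁺ ∘ Sum.map (from (∈-freeVars φ)) (from (∈-freeVars ψ))
              ∘ ∈-++⁻ (freeOccurrences φ) ∘ to (∈-freeVars (φ ∧ ψ))))
      (∧ʳ (conjunction-representable c) (conjunction-representable d))
      where
      ∈-++⁺ : ∀ {xs ys : List Var} {z} → z ∈ˡ xs ⊎ z ∈ˡ ys → z ∈ˡ xs ++ ys
      ∈-++⁺ = [ ∈-++⁺ˡ , ∈-++⁺ʳ _ ]′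

    query-representable : ∀ {φ} → ExistentialOf (ConjunctionOf 𝒜) φ →
                          Representable (freeVars φ) φ
    query-representable (matrix c) = conjunction-representable c
    query-representable (∃ᶠ x {φ} q) with x ∈ˡ? freeVars φ
    -- The bound variable is moved from its sorted place to the end of the label, where it can be
    -- projected away.
    ... | yes x∈ = ∃ʳ fv x x∉fv (normaliseʳ
            (Unique-resp-↭ (++-comm [ x ] fv)
              (All.tabulate (λ z∈ x≡z → x∉fv (subst (_∈ˡ fv) (sym x≡z) z∈)) ∷ freeVars-! (∃ᶠ x φ)))
            (mk⇔ ∈⁺ ∈⁻) (query-representable q))
      where
      fv = freeVars (∃ᶠ x φ)

      x∉fv : x ∉ˡ fv
      x∉fv x∈fv = proj₂ (∈-filter⁻ (λ y → ¬? (y ≟ x)) {xs = freeOccurrences φ}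
                           (to (∈-freeVars (∃ᶠ x φ)) x∈fv)) refl

      ∈⁺ : ∀ {z} → z ∈ˡ freeVars φ → z ∈ˡ fv ++ [ x ]
      ∈⁺ {z} z∈ with z ≟ x
      ... | yes z≡x = ∈-++⁺ʳ fv (here z≡x)
      ... | no z≢x  = ∈-++⁺ˡ (from (∈-freeVars (∃ᶠ x φ))
              (∈-filter⁺ (λ y → ¬? (y ≟ x)) (to (∈-freeVars φ) z∈) z≢x))

      ∈⁻ : ∀ {z} → z ∈ˡ fv ++ [ x ] → z ∈ˡ freeVars φ
      ∈⁻ z∈ with ∈-++⁻ fv z∈
      ... | inj₁ z∈fv        = from (∈-freeVars φ)
              (proj₁ (∈-filter⁻ (λ y → ¬? (y ≟ x)) (to (∈-freeVars (∃ᶠ x φ)) z∈fv)))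
      ... | inj₂ (here refl) = x∈
    ... | no x∉ = subst (λ xs → Representable xs (∃ᶠ x φ)) (sym fv≡)
            (vacuous-∃ʳ (freeVars φ) x x∉ (query-representable q))
      where
      fv≡ : freeVars (∃ᶠ x φ) ≡ freeVars φ
      fv≡ = cong (λ l → sort ≤-decTotalOrder (deduplicate _≟_ l))
        (List.filter-all (λ y → ¬? (y ≟ x))
          (All.tabulate λ { z∈ refl → x∉ (from (∈-freeVars φ) z∈) }))

-- From terms to queries

unrotate : (l : List A) → ∃[ m ] rotate m ≡ l
unrotate l with initLast l
... | []      = [] , refl
... | m ∷ʳ′ a = a ∷ m , refl

rotate-↭ : (l : List A) → rotate l ↭ l
rotate-↭ []      = refl
rotate-↭ (a ∷ l) = ++-comm l [ a ]

swapLast-↭ : (l : List A) → swapLast l ↭ l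
swapLast-↭ []              = refl
swapLast-↭ (a ∷ [])        = refl
swapLast-↭ (a ∷ b ∷ [])    = swap b a refl
swapLast-↭ (a ∷ b ∷ c ∷ l) = prep a (swapLast-↭ (b ∷ c ∷ l))

-- Even and odd numbers provide two disjoint copies of the variables, so the arguments of `J` can be
-- renamed apart without a choice of fresh variables.
double : ℕ → ℕ
double zero    = zero
double (suc n) = suc (suc (double n))

double-injective : ∀ {m n} → double m ≡ double n → m ≡ n
double-injective {zero}  {zero}  _  = refl
double-injective {suc m} {suc n} eq =
  cong suc (double-injective (suc-injective (suc-injective eq)))

double≢suc-double : ∀ m n → double m ≢ suc (double n)
double≢suc-double (suc m) (suc n) eq =
  double≢suc-double m n (suc-injective (suc-injective eq))

-- Glues assignments for the two copies of the variables into a single one.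
interleave : (Var → A) → (Var → A) → (Var → A)
interleave f g zero          = f zero
interleave f g (suc zero)    = g zero
interleave f g (suc (suc n)) = interleave (f ∘ suc) (g ∘ suc) n

interleave-even : ∀ (f g : Var → A) n → interleave f g (double n) ≡ f n
interleave-even f g zero    = refl
interleave-even f g (suc n) = interleave-even (f ∘ suc) (g ∘ suc) n

interleave-odd : ∀ (f g : Var → A) n → interleave f g (suc (double n)) ≡ g n
interleave-odd f g zero    = refl
interleave-odd f g (suc n) = interleave-odd (f ∘ suc) (g ∘ suc) n

-- Renaming variables and quantifier prefixes

module _ {𝓢 : RelationSymbols σ} where

  -- This renaming does not avoid capture; it is applied to conjunctions of atoms, which bind no
  -- variables.
  rename : (Var → Var) → Formula 𝓢 → Formula 𝓢
  rename ρ (atom R xs) = atom R (Vec.map ρ xs)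
  rename ρ (x ≗ y)     = ρ x ≗ ρ y
  rename ρ (φ ∧ ψ)     = rename ρ φ ∧ rename ρ ψ
  rename ρ (∃ᶠ x φ)    = ∃ᶠ (ρ x) (rename ρ φ)

  rename-over : ∀ ρ (φ : Formula 𝓢) {τ : Pred (Symbol 𝓢) ℓ} → rename ρ φ overᶠ τ → φ overᶠ τ
  rename-over ρ (atom R xs) o         = o
  rename-over ρ (x ≗ y)     o         = o
  rename-over ρ (φ ∧ ψ)     (oφ , oψ) = rename-over ρ φ oφ , rename-over ρ ψ oψ
  rename-over ρ (∃ᶠ x φ)    o         = rename-over ρ φ o

  ∃* : List Var → Formula 𝓢 → Formula 𝓢
  ∃* xs φ = List.foldr ∃ᶠ φ xs

  ∃*-over : ∀ xs (φ : Formula 𝓢) {τ : Pred (Symbol 𝓢) ℓ} → ∃* xs φ overᶠ τ → φ overᶠ τ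
  ∃*-over []       φ o = o
  ∃*-over (x ∷ xs) φ o = ∃*-over xs φ o

  ∃*-existential : ∀ {P : Pred (Formula 𝓢) σ} xs {φ} → φ ∈ P → ExistentialOf P (∃* xs φ)
  ∃*-existential []       φ∈ = matrix φ∈
  ∃*-existential (x ∷ xs) φ∈ = ∃ᶠ x (∃*-existential xs φ∈)

  freeOccurrences-∃* : ∀ xs (φ : Formula 𝓢) {z} →
    z ∈ˡ freeOccurrences (∃* xs φ) ⇔ (z ∈ˡ freeOccurrences φ × z ∉ˡ xs)
  freeOccurrences-∃* []       φ = mk⇔ (λ z∈ → z∈ , λ ()) proj₁
  freeOccurrences-∃* (x ∷ xs) φ = mk⇔
    (λ z∈ → let z∈′ , z≢x = ∈-filter⁻ (λ y → ¬? (y ≟ x)) z∈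
                z∈φ , z∉xs = to (freeOccurrences-∃* xs φ) z∈′
            in z∈φ , λ { (here z≡x) → z≢x z≡x ; (there z∈xs) → z∉xs z∈xs })
    (λ (z∈φ , z∉) → ∈-filter⁺ (λ y → ¬? (y ≟ x))
      (from (freeOccurrences-∃* xs φ) (z∈φ , z∉ ∘ there)) (z∉ ∘ here))

  module _ (𝔄 : Model 𝓢 ℓ) where

    Sat-∃*⁺ : ∀ xs φ .(o : ∃* xs φ overᶠ vocabulary 𝔄) {f} →
              Sat 𝔄 f φ (∃*-over xs φ o) → Sat 𝔄 f (∃* xs φ) o
    Sat-∃*⁺ []       φ o sφ = sφ
    -- The witness is the value that `f` already has at `x`, so the update changes nothing.
    Sat-∃*⁺ (x ∷ xs) φ o {f} sφ = f x ,
      Sat-cong 𝔄 (∃* xs φ) o (λ {z} _ → sym (update-self {𝓢 = 𝓢} f x z)) (Sat-∃*⁺ xs φ o sφ)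

    -- The assignment `g` is `f` with the witnesses of the whole prefix entered.
    Sat-∃*⁻ : ∀ xs φ .(o : ∃* xs φ overᶠ vocabulary 𝔄) {f} → Sat 𝔄 f (∃* xs φ) o →
              ∃[ g ] (Sat 𝔄 g φ (∃*-over xs φ o) × (∀ {z} → z ∉ˡ xs → g z ≡ f z))
    Sat-∃*⁻ []       φ o {f} sφ = f , sφ , λ _ → refl
    Sat-∃*⁻ (x ∷ xs) φ o {f} (a , sφ) with g , sg , g≡ ← Sat-∃*⁻ xs φ o sφ =
      g , sg , λ z∉ → trans (g≡ (z∉ ∘ there)) (update-≢ {𝓢 = 𝓢} f a (z∉ ∘ here))

  -- Members of xs go to their (first) index, the other variables z to length xs + z.
  position : List Var → Var → Var
  position []       = id
  position (x ∷ xs) = update {𝓢 = 𝓢} (suc ∘ position xs) x 0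

  -- A left inverse of `position xs`: once `xs` is exhausted, the remaining counter is the variable
  -- itself. It carries assignments back along the renaming.
  atPosition : List Var → Var → Var
  atPosition []       n       = n
  atPosition (x ∷ xs) zero    = x
  atPosition (x ∷ xs) (suc n) = atPosition xs n

  atPosition-position : ∀ xs z → atPosition xs (position xs z) ≡ z
  atPosition-position []       z = refl
  atPosition-position (x ∷ xs) z with z ≟ x
  ... | yes refl rewrite update-≡ {𝓢 = 𝓢} (suc ∘ position xs) x 0 = refl
  ... | no z≢x   rewrite update-≢ {𝓢 = 𝓢} (suc ∘ position xs) 0 z≢x = atPosition-position xs z

  -- Uniqueness keeps later entries from being sent to 0 along with the first. Consequently a
  -- renamed head is already in the order of the free variables.
  position-< : ∀ {xs} → Unique xs → AllPairs _<_ (map (position xs) xs)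
  position-< []                       = []
  position-< {x ∷ xs} (x∉xs ∷ xs!) = subst (AllPairs _<_) (sym eq)
    (All.tabulate 0< ∷ AllPairs.map⁺ (AllPairs.map s<s (position-< xs!)))
    where
    0< : ∀ {n} → n ∈ˡ map suc (map (position xs) xs) → 0 < n
    0< n∈ with _ , _ , refl ← ∈-map⁻ suc n∈ = z<s

    eq : map (position (x ∷ xs)) (x ∷ xs) ≡ 0 ∷ map suc (map (position xs) xs)
    eq = cong₂ _∷_ (update-≡ {𝓢 = 𝓢} (suc ∘ position xs) x 0)
      (trans (map-cong-∈ λ z∈xs → update-≢ {𝓢 = 𝓢} (suc ∘ position xs) 0
                λ z≡x → All.lookup x∉xs z∈xs (sym z≡x))
             (List.map-∘ xs))

-- Presentations of terms

module _ {𝓢 : RelationSymbols σ} {𝒯 𝒜} (fragment : Fragment {𝓢 = 𝓢} 𝒯 𝒜) where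

  open Fragment fragment

  rename-atom : ∀ ρ {φ} → φ ∈ 𝒜 → rename ρ φ ∈ 𝒜
  rename-atom ρ φ∈ with atomic φ∈
  ... | atom R xs = atom∈ R (Vec.map ρ xs)
  ... | x ≗ y     = from ≗⇔ (to ≗⇔ φ∈)

  rename-conjunction : ∀ ρ {φ} → ConjunctionOf 𝒜 φ → ConjunctionOf 𝒜 (rename ρ φ)
  rename-conjunction ρ (single φ∈) = single (rename-atom ρ φ∈)
  rename-conjunction ρ (c ∧ d)     = rename-conjunction ρ c ∧ rename-conjunction ρ d

  freeOccurrences-rename : ∀ ρ {φ} → ConjunctionOf 𝒜 φ →
    freeOccurrences (rename ρ φ) ≡ map ρ (freeOccurrences φ)
  freeOccurrences-rename ρ (single φ∈) with atomic φ∈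
  ... | atom R xs = Vec.toList-map ρ xs
  ... | x ≗ y     = refl
  freeOccurrences-rename ρ (_∧_ {φ} {ψ} c d) =
    trans (cong₂ _++_ (freeOccurrences-rename ρ c) (freeOccurrences-rename ρ d))
          (sym (List.map-++ ρ (freeOccurrences φ) (freeOccurrences ψ)))

  ∈-rename : ∀ ρ {φ z} → ConjunctionOf 𝒜 φ → z ∈ˡ freeOccurrences φ →
             ρ z ∈ˡ freeOccurrences (rename ρ φ)
  ∈-rename ρ {z = z} c z∈ = subst (ρ z ∈ˡ_) (sym (freeOccurrences-rename ρ c)) (∈-map⁺ ρ z∈)

  -- The substitution lemma. Without bound variables it holds for every `ρ`, including the one in
  -- `I-mergeᵖ` that identifies two variables.
  Sat-rename : ∀ (𝔄 : Model 𝓢 ℓ) f ρ {φ} → ConjunctionOf 𝒜 φ →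
    .(o : rename ρ φ overᶠ vocabulary 𝔄) →
    Sat 𝔄 f (rename ρ φ) o ⇔ Sat 𝔄 (f ∘ ρ) φ (rename-over ρ φ o)
  Sat-rename 𝔄 f ρ (single φ∈) o with atomic φ∈
  ... | atom R xs = mk⇔ (subst (λ t → interp 𝔄 R o t) (sym (Vec.map-∘ f ρ xs)))
                        (subst (λ t → interp 𝔄 R o t) (Vec.map-∘ f ρ xs))
  ... | x ≗ y     = mk⇔ id id
  Sat-rename 𝔄 f ρ (c ∧ d) o =
    let φ⇔ = Sat-rename 𝔄 f ρ c (proj₁ o); ψ⇔ = Sat-rename 𝔄 f ρ d (proj₂ o)
    in mk⇔ (Product.map (to φ⇔) (to ψ⇔)) (Product.map (from φ⇔) (from ψ⇔))

  -- A term as the set of values of the tuple head under the assignments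
  -- satisfying body: the variables of body outside head are implicitly
  -- existential, and so need no care when bodies are conjoined or renamed.
  record Presentation (ℓ : Level) (T : Term 𝓢) : Set (σ ⊔ lsuc ℓ) where
    field
      body     : Formula 𝓢
      head     : List Var
      body∈    : ConjunctionOf 𝒜 body
      head!    : Unique head
      head⊆    : ∀ {z} → z ∈ˡ head → z ∈ˡ freeOccurrences body
      arity≡   : (𝔄 : Model 𝓢 ℓ) .(o : T overᵗ vocabulary 𝔄) →
                 proj₁ (⟦ T ⟧ᵗ 𝔄 o) ≡ length head
      sound    : (𝔄 : Model 𝓢 ℓ) .(oφ : body overᶠ vocabulary 𝔄) .(o : T overᵗ vocabulary 𝔄) →
                 ∀ f → Sat 𝔄 f body oφ → ⟦ T ⟧ᵗ 𝔄 o ∋ map f head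
      complete : (𝔄 : Model 𝓢 ℓ) .(oφ : body overᶠ vocabulary 𝔄) .(o : T overᵗ vocabulary 𝔄) →
                 ∀ l → ⟦ T ⟧ᵗ 𝔄 o ∋ l → ∃[ f ] (Sat 𝔄 f body oφ × map f head ≡ l)

  open Presentation

  relᵖ : ∀ R → Presentation ℓ (rel R)
  -- Distinct arguments allow an assignment to produce any tuple of the relation.
  relᵖ R with xs , xs≡ ← toList-surjective (upTo (arity 𝓢 R)) (List.length-upTo (arity 𝓢 R)) = record
    { body     = atom R xs
    ; head     = toList xs
    ; body∈    = single (atom∈ R xs)
    ; head!    = xs!
    ; head⊆    = id
    ; arity≡   = λ _ _ → sym (Vec.length-toList xs)
    ; sound    = λ 𝔄 oφ o f r → Vec.map f xs , Vec.toList-map f xs , r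
    ; complete = λ where
        𝔄 oφ o _ (t , refl , r) →
          let f , eq = interpolate {𝓢 = 𝓢} (nonempty 𝔄) xs! (toList t)
                         (trans (Vec.length-toList t) (sym (Vec.length-toList xs)))
          in f , subst (λ t → interp 𝔄 R o t)
                   (toList-injective (sym (trans (Vec.toList-map f xs) eq))) r , eq
    }
    where
    xs! : Unique (toList xs)
    xs! = subst Unique (sym xs≡) (Unique.upTo⁺ (arity 𝓢 R))

  eᵖ : e ∈ 𝒯 → Presentation ℓ e
  eᵖ e∈ = record
    { body     = 0 ≗ 1
    ; head     = 0 ∷ 1 ∷ []
    ; body∈    = single (from ≗⇔ e∈)
    ; head!    = ((λ ()) ∷ []) ∷ [] ∷ []
    ; head⊆    = id
    ; arity≡   = λ _ _ → refl
    ; sound    = λ 𝔄 oφ o f eq →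
        f 0 ∷ f 1 ∷ [] , refl , f 0 , cong (λ a → f 0 ∷ a ∷ []) (sym eq)
    ; complete = λ where _ _ _ _ (_ , refl , a , refl) → (λ _ → a) , refl , refl
    }

  -- A list lies in `p T` when its rotation lies in `T`, so the new head has to rotate to the old
  -- one.
  pᵖ : ∀ {T} → Presentation ℓ T → Presentation ℓ (p T)
  pᵖ {T = T} P with ys , rotate≡ ← unrotate (head P) = record
    { body     = body P
    ; head     = ys
    ; body∈    = body∈ P
    ; head!    = Unique-resp-↭ head↭ys (head! P)
    ; head⊆    = head⊆ P ∘ ∈-resp-↭ (↭-sym head↭ys)
    ; arity≡   = λ 𝔄 o → trans (p-arity (⟦ T ⟧ᵗ 𝔄 o))
                           (trans (arity≡ P 𝔄 o) (↭-length head↭ys))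
    ; sound    = λ 𝔄 oφ o f sφ → p-∋⁺ (⟦ T ⟧ᵗ 𝔄 o) _
        (subst (⟦ T ⟧ᵗ 𝔄 o ∋_) (map-head f) (sound P 𝔄 oφ o f sφ))
    ; complete = λ 𝔄 oφ o l p∋l →
        let f , sφ , eq = complete P 𝔄 oφ o _ (p-∋⁻ (⟦ T ⟧ᵗ 𝔄 o) l p∋l)
        in f , sφ , rotate-injective (map f ys) l (trans (sym (map-head f)) eq)
    }
    where
    head↭ys : head P ↭ ys
    head↭ys = subst (_↭ ys) rotate≡ (rotate-↭ ys)

    map-head : ∀ {A : Set ℓ} (f : Var → A) → map f (head P) ≡ rotate (map f ys)
    map-head f = trans (cong (map f) (sym rotate≡)) (map-rotate f ys)

  sᵖ : ∀ {T} → Presentation ℓ T → Presentation ℓ (s T)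
  sᵖ {T = T} P = record
    { body     = body P
    ; head     = swapLast (head P)
    ; body∈    = body∈ P
    ; head!    = Unique-resp-↭ (↭-sym (swapLast-↭ (head P))) (head! P)
    ; head⊆    = head⊆ P ∘ ∈-resp-↭ (swapLast-↭ (head P))
    ; arity≡   = λ 𝔄 o → trans (s-arity (⟦ T ⟧ᵗ 𝔄 o))
                           (trans (arity≡ P 𝔄 o) (sym (length-swapLast (head P))))
    ; sound    = λ 𝔄 oφ o f sφ → s-∋⁺ (⟦ T ⟧ᵗ 𝔄 o) _ (subst (⟦ T ⟧ᵗ 𝔄 o ∋_)
        (sym (trans (cong swapLast (map-swapLast f (head P))) (swapLast-involutive _)))
        (sound P 𝔄 oφ o f sφ))
    ; complete = λ 𝔄 oφ o l s∋l →
        let f , sφ , eq = complete P 𝔄 oφ o _ (s-∋⁻ (⟦ T ⟧ᵗ 𝔄 o) l s∋l)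
        in f , sφ , trans (map-swapLast f (head P))
                      (trans (cong swapLast eq) (swapLast-involutive l))
    }

  I-trivialᵖ : ∀ {T} (P : Presentation ℓ T) → length (head P) < 2 → Presentation ℓ (I T)
  I-trivialᵖ {T = T} P head<2 = record
    { body     = body P
    ; head     = head P
    ; body∈    = body∈ P
    ; head!    = head! P
    ; head⊆    = head⊆ P
    ; arity≡   = λ 𝔄 o → trans (cong proj₁ (I≡ 𝔄 o)) (arity≡ P 𝔄 o)
    ; sound    = λ 𝔄 oφ o f sφ → subst (_∋ _) (sym (I≡ 𝔄 o)) (sound P 𝔄 oφ o f sφ)
    ; complete = λ 𝔄 oφ o l I∋l → complete P 𝔄 oφ o l (subst (_∋ l) (I≡ 𝔄 o) I∋l)
    }
    where
    I≡ : ∀ 𝔄 .o → ⟦ I T ⟧ᵗ 𝔄 o ≡ ⟦ T ⟧ᵗ 𝔄 o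
    I≡ 𝔄 o = I-trivial (⟦ T ⟧ᵗ 𝔄 o) (subst (_< 2) (sym (arity≡ P 𝔄 o)) head<2)

  -- Substituting `x` for `y` in the body forces the last two entries to agree without an equality
  -- atom, which also serves the fragment without `e`. Conversely, a tuple whose last two entries
  -- agree comes from an assignment with equal values at `x` and `y`, which the substitution leaves
  -- unchanged.
  I-mergeᵖ : ∀ {T} (P : Presentation ℓ T) xs x y → head P ≡ xs ++ x ∷ y ∷ [] →
             Presentation ℓ (I T)
  I-mergeᵖ {ℓ = ℓ} {T} P xs x y head≡ = record
    { body     = rename ρ (body P)
    ; head     = xs ++ [ x ]
    ; body∈    = rename-conjunction ρ (body∈ P)
    ; head!    = AllPairs.tail y∷xs∷ʳx!
    ; head⊆    = λ z∈ → subst (_∈ˡ freeOccurrences (rename ρ (body P))) (ρ-fixes z∈)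
        (∈-rename ρ (body∈ P) (head⊆ P (∈-resp-↭ (↭-sym head↭) (there z∈))))
    ; arity≡   = λ 𝔄 o → trans (I-arity (⟦ T ⟧ᵗ 𝔄 o) (arityᵀ 𝔄 o)) (sym (length-∷ʳ xs x))
    ; sound    = λ 𝔄 oφ o f sφ → subst (⟦ I T ⟧ᵗ 𝔄 o ∋_) (sym (List.map-++ f xs [ x ]))
        (I-∋⁺ (⟦ T ⟧ᵗ 𝔄 o) (arityᵀ 𝔄 o) (map f xs) (f x)
          (subst (⟦ T ⟧ᵗ 𝔄 o ∋_) (map-head f)
            (sound P 𝔄 (rename-over ρ (body P) oφ) o (f ∘ ρ)
              (to (Sat-rename 𝔄 f ρ (body∈ P) oφ) sφ))))
    ; complete = λ 𝔄 oφ o l I∋l → case (I-∋⁻ (⟦ T ⟧ᵗ 𝔄 o) (arityᵀ 𝔄 o) I∋l) of λ where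
        (m , a , refl , r) → case (complete P 𝔄 (rename-over ρ (body P) oφ) o _ r) of λ where
          (f , sφ , eq) → case (∷ʳ∷ʳ-injective (map f xs) m
              (trans (sym (List.map-++ f xs (x ∷ y ∷ [])))
                (subst (λ h → map f h ≡ _) head≡ eq))) of λ where
            (refl , refl , fy≡fx) → f ,
              from (Sat-rename 𝔄 f ρ (body∈ P) oφ)
                (Sat-cong 𝔄 (body P) _ (λ {z} _ → sym (f∘ρ≗f f fy≡fx z)) sφ) ,
              List.map-++ f xs [ x ]
    }
    where
    ρ : Var → Var
    ρ = update {𝓢 = 𝓢} id y x

    f∘ρ≗f : ∀ {A : Set ℓ} (f : Var → A) → f y ≡ f x → ∀ z → f (ρ z) ≡ f z
    f∘ρ≗f f fy≡fx z with z ≟ y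
    ... | yes refl = trans (cong f (update-≡ {𝓢 = 𝓢} id y x)) (sym fy≡fx)
    ... | no z≢y   = cong f (update-≢ {𝓢 = 𝓢} id x z≢y)

    head↭ : head P ↭ y ∷ xs ++ [ x ]
    head↭ = subst (_↭ y ∷ xs ++ [ x ])
      (trans (List.++-assoc xs [ x ] [ y ]) (sym head≡)) (++-comm (xs ++ [ x ]) [ y ])

    y∷xs∷ʳx! : Unique (y ∷ xs ++ [ x ])
    y∷xs∷ʳx! = Unique-resp-↭ head↭ (head! P)

    ρ-fixes : ∀ {z} → z ∈ˡ xs ++ [ x ] → ρ z ≡ z
    ρ-fixes z∈ = update-≢ {𝓢 = 𝓢} id x
      λ z≡y → All.lookup (AllPairs.head y∷xs∷ʳx!) z∈ (sym z≡y)

    arityᵀ : ∀ 𝔄 .o → proj₁ (⟦ T ⟧ᵗ 𝔄 o) ≡ suc (suc (length xs))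
    arityᵀ 𝔄 o = trans (arity≡ P 𝔄 o) (trans (cong length head≡) (length-∷ʳ∷ʳ xs x y))

    map-head : ∀ {A : Set ℓ} (f : Var → A) → map (f ∘ ρ) (head P) ≡ map f xs ++ f x ∷ f x ∷ []
    map-head f = trans (cong (map (f ∘ ρ)) head≡) (trans (List.map-++ (f ∘ ρ) xs _)
      (cong₂ _++_ (map-cong-∈ (cong f ∘ ρ-fixes ∘ ∈-++⁺ˡ))
        (cong₂ (λ a b → a ∷ b ∷ []) (cong f (ρ-fixes (∈-++⁺ʳ xs (here refl))))
                                    (cong f (update-≡ {𝓢 = 𝓢} id y x)))))

  Iᵖ : ∀ {T} → Presentation ℓ T → Presentation ℓ (I T)
  Iᵖ {ℓ = ℓ} {T} P = go (initLast (head P)) refl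
    where
    go : ∀ {h} → InitLast h → head P ≡ h → Presentation ℓ (I T)
    go []         eq = I-trivialᵖ P (subst (λ h → length h < 2) (sym eq) z<s)
    go (xs ∷ʳ′ y) eq with initLast xs
    ... | []       = I-trivialᵖ P (subst (λ h → length h < 2) (sym eq) (s<s z<s))
    ... | ys ∷ʳ′ x = I-mergeᵖ P ys x y (trans eq (List.++-assoc ys [ x ] [ y ]))

  -- The renamed bodies share no variable, inside or outside the heads, so assignments satisfying
  -- them separately combine by `interleave`.
  Jᵖ : ∀ {T T′} → Presentation ℓ T → Presentation ℓ T′ → Presentation ℓ (J T T′)
  Jᵖ {ℓ = ℓ} {T = T} {T′} P Q = record
    { body     = φ ∧ ψ
    ; head     = map double (head P) ++ map (suc ∘ double) (head Q)
    ; body∈    = rename-conjunction double (body∈ P) ∧ rename-conjunction (suc ∘ double) (body∈ Q)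
    ; head!    = Unique.++⁺ (Unique.map⁺ double-injective (head! P))
                            (Unique.map⁺ (double-injective ∘ suc-injective) (head! Q)) disjoint
    ; head⊆    = λ z∈ → case (∈-++⁻ (map double (head P)) z∈) of λ where
        (inj₁ z∈P) → case (∈-map⁻ double z∈P) of λ where
          (x , x∈ , refl) → ∈-++⁺ˡ (∈-rename double (body∈ P) (head⊆ P x∈))
        (inj₂ z∈Q) → case (∈-map⁻ (suc ∘ double) z∈Q) of λ where
          (x , x∈ , refl) → ∈-++⁺ʳ (freeOccurrences φ)
                              (∈-rename (suc ∘ double) (body∈ Q) (head⊆ Q x∈))
    ; arity≡   = λ 𝔄 o → trans
        (cong₂ _+_ (trans (arity≡ P 𝔄 (proj₁ o)) (sym (List.length-map double (head P))))
                   (trans (arity≡ Q 𝔄 (proj₂ o)) (sym (List.length-map (suc ∘ double) (head Q)))))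
        (sym (List.length-++ (map double (head P))))
    ; sound    = λ 𝔄 oφ o f (sφ , sψ) → subst (⟦ J T T′ ⟧ᵗ 𝔄 o ∋_) (sym (map-head f))
        (J-∋⁺ (⟦ T ⟧ᵗ 𝔄 (proj₁ o)) (⟦ T′ ⟧ᵗ 𝔄 (proj₂ o))
          (sound P 𝔄 (rename-over double (body P) (proj₁ oφ)) (proj₁ o) (f ∘ double)
            (to (Sat-rename 𝔄 f double (body∈ P) (proj₁ oφ)) sφ))
          (sound Q 𝔄 (rename-over (suc ∘ double) (body Q) (proj₂ oφ)) (proj₂ o) (f ∘ suc ∘ double)
            (to (Sat-rename 𝔄 f (suc ∘ double) (body∈ Q) (proj₂ oφ)) sψ)))
    ; complete = λ 𝔄 oφ o l J∋l →
        let m , n , l≡ , r , q = J-∋⁻ (⟦ T ⟧ᵗ 𝔄 (proj₁ o)) (⟦ T′ ⟧ᵗ 𝔄 (proj₂ o)) J∋l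
            f , sφ , f≡ = complete P 𝔄 (rename-over double (body P) (proj₁ oφ)) (proj₁ o) m r
            g , sψ , g≡ = complete Q 𝔄 (rename-over (suc ∘ double) (body Q) (proj₂ oφ)) (proj₂ o) n q
            h = interleave f g
        in h ,
           ( from (Sat-rename 𝔄 h double (body∈ P) (proj₁ oφ))
               (Sat-cong 𝔄 (body P) _ (λ {z} _ → sym (interleave-even f g z)) sφ)
           , from (Sat-rename 𝔄 h (suc ∘ double) (body∈ Q) (proj₂ oφ))
               (Sat-cong 𝔄 (body Q) _ (λ {z} _ → sym (interleave-odd f g z)) sψ)) ,
           trans (map-head h) (trans (cong₂ _++_
             (trans (List.map-cong (interleave-even f g) (head P)) f≡)
             (trans (List.map-cong (interleave-odd f g) (head Q)) g≡)) (sym l≡))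
    }
    where
    φ = rename double (body P)
    ψ = rename (suc ∘ double) (body Q)

    disjoint : Disjoint (map double (head P)) (map (suc ∘ double) (head Q))
    disjoint (z∈P , z∈Q) with x , _ , refl ← ∈-map⁻ double z∈P
      with y , _ , eq ← ∈-map⁻ (suc ∘ double) z∈Q = double≢suc-double x y eq

    map-head : ∀ {A : Set ℓ} (f : Var → A) →
               map f (map double (head P) ++ map (suc ∘ double) (head Q)) ≡
               map (f ∘ double) (head P) ++ map (f ∘ suc ∘ double) (head Q)
    map-head f = trans (List.map-++ f (map double (head P)) _)
      (cong₂ _++_ (sym (List.map-∘ (head P))) (sym (List.map-∘ (head Q))))

  ∃-trivialᵖ : ∀ {T} (P : Presentation ℓ T) → head P ≡ [] → Presentation ℓ (∃ᵗ T)
  ∃-trivialᵖ {T = T} P head≡ = record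
    { body     = body P
    ; head     = head P
    ; body∈    = body∈ P
    ; head!    = head! P
    ; head⊆    = head⊆ P
    ; arity≡   = λ 𝔄 o → trans (cong proj₁ (∃≡ 𝔄 o)) (arity≡ P 𝔄 o)
    ; sound    = λ 𝔄 oφ o f sφ → subst (_∋ _) (sym (∃≡ 𝔄 o)) (sound P 𝔄 oφ o f sφ)
    ; complete = λ 𝔄 oφ o l ∃∋l → complete P 𝔄 oφ o l (subst (_∋ l) (∃≡ 𝔄 o) ∃∋l)
    }
    where
    ∃≡ : ∀ 𝔄 .o → ⟦ ∃ᵗ T ⟧ᵗ 𝔄 o ≡ ⟦ T ⟧ᵗ 𝔄 o
    ∃≡ 𝔄 o = ∃-trivial (⟦ T ⟧ᵗ 𝔄 o) (trans (arity≡ P 𝔄 o) (cong length head≡))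

  -- Variables outside the head are implicitly existential, so dropping `x` from the head already
  -- quantifies it.
  ∃-projectᵖ : ∀ {T} (P : Presentation ℓ T) xs x → head P ≡ xs ++ [ x ] → Presentation ℓ (∃ᵗ T)
  ∃-projectᵖ {T = T} P xs x head≡ = record
    { body     = body P
    ; head     = xs
    ; body∈    = body∈ P
    ; head!    = AllPairs.tail (Unique-resp-↭ head↭ (head! P))
    ; head⊆    = head⊆ P ∘ ∈-resp-↭ (↭-sym head↭) ∘ there
    ; arity≡   = λ 𝔄 o → ∃-arity (⟦ T ⟧ᵗ 𝔄 o) (arityᵀ 𝔄 o)
    ; sound    = λ 𝔄 oφ o f sφ → from (∃-∋ (⟦ T ⟧ᵗ 𝔄 o) (arityᵀ 𝔄 o) (map f xs))
        (f x , subst (⟦ T ⟧ᵗ 𝔄 o ∋_) (map-head f) (sound P 𝔄 oφ o f sφ))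
    ; complete = λ 𝔄 oφ o l ∃∋l →
        let a , r = to (∃-∋ (⟦ T ⟧ᵗ 𝔄 o) (arityᵀ 𝔄 o) l) ∃∋l
            f , sφ , eq = complete P 𝔄 oφ o _ r
        in f , sφ , List.∷ʳ-injectiveˡ (map f xs) l (trans (sym (map-head f)) eq)
    }
    where
    head↭ : head P ↭ x ∷ xs
    head↭ = subst (_↭ x ∷ xs) (sym head≡) (++-comm xs [ x ])

    arityᵀ : ∀ 𝔄 .o → proj₁ (⟦ T ⟧ᵗ 𝔄 o) ≡ suc (length xs)
    arityᵀ 𝔄 o = trans (arity≡ P 𝔄 o) (trans (cong length head≡) (length-∷ʳ xs x))

    map-head : (f : Var → A) → map f (head P) ≡ map f xs ++ [ f x ]
    map-head f = trans (cong (map f) head≡) (List.map-++ f xs [ x ])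

  ∃ᵖ : ∀ {T} → Presentation ℓ T → Presentation ℓ (∃ᵗ T)
  ∃ᵖ {ℓ = ℓ} {T} P = go (initLast (head P)) refl
    where
    go : ∀ {h} → InitLast h → head P ≡ h → Presentation ℓ (∃ᵗ T)
    go []         eq = ∃-trivialᵖ P eq
    go (xs ∷ʳ′ x) eq = ∃-projectᵖ P xs x eq

  present : ∀ T → T ∈ 𝒯 → Presentation ℓ T
  present (rel R)  T∈ = relᵖ R
  present e        T∈ = eᵖ T∈
  present (p T)    T∈ = pᵖ (present T (to p⇔ T∈))
  present (s T)    T∈ = sᵖ (present T (to s⇔ T∈))
  present (I T)    T∈ = Iᵖ (present T (to I⇔ T∈))
  present (J T T′) T∈ = Jᵖ (present T (proj₁ (to J⇔ T∈))) (present T′ (proj₂ (to J⇔ T∈)))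
  present (∃ᵗ T)   T∈ = ∃ᵖ (present T (to ∃⇔ T∈))

  -- Renaming by `position` makes the head increasing, and quantifying the other variables makes it
  -- the list of free variables. Its order then agrees with the order of entries in the relation
  -- that the formula defines.
  presentation⇒query : ∀ {T} → Presentation ℓ T →
    ∃[ φ ] (φ ∈ ExistentialOf (ConjunctionOf 𝒜) × Equivalent ℓ φ T)
  presentation⇒query {T = T} P =
    φ , ∃*-existential bound (rename-conjunction ρ (body∈ P)) , λ 𝔄 oφ o →
      ∋⇔⇒≋
      (trans (cong length freeVars≡)
        (trans (List.length-map ρ (head P)) (sym (arity≡ P 𝔄 o))))
      λ l → mk⇔
        (λ φ∋l →
          let f , sφ , f≡ = to (⟦⟧ᶠ-∋ 𝔄 φ oφ l) φ∋l
              -- `g` can differ from `f` only at quantified variables, hence not on the renamed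
              -- head.
              g , sψ , g≡f = Sat-∃*⁻ 𝔄 bound ψ oφ sφ
          in subst (⟦ T ⟧ᵗ 𝔄 o ∋_)
               (trans (List.map-∘ (head P))
                 (trans (map-cong-∈ (g≡f ∘ ∉bound))
                   (subst (λ xs → map f xs ≡ l) freeVars≡ f≡)))
               (sound P 𝔄 (rename-over ρ (body P) (∃*-over bound ψ oφ)) o (g ∘ ρ)
                 (to (Sat-rename 𝔄 g ρ (body∈ P) (∃*-over bound ψ oφ)) sψ)))
        (λ T∋l →
          let f , sb , f≡ = complete P 𝔄 (rename-over ρ (body P) (∃*-over bound ψ oφ)) o l T∋l
              -- Chosen so that `g ∘ ρ` agrees with `f` everywhere.
              g = f ∘ atPosition {𝓢 = 𝓢} (head P)
              gρ≡f = λ z → cong f (atPosition-position {𝓢 = 𝓢} (head P) z)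
          in from (⟦⟧ᶠ-∋ 𝔄 φ oφ l)
               ( g
               , Sat-∃*⁺ 𝔄 bound ψ oφ (from (Sat-rename 𝔄 g ρ (body∈ P) (∃*-over bound ψ oφ))
                   (Sat-cong 𝔄 (body P) _ (λ {z} _ → sym (gρ≡f z)) sb))
               , trans (cong (map g) freeVars≡) (trans (sym (List.map-∘ (head P)))
                   (trans (List.map-cong gρ≡f (head P)) f≡))))
    where
    ρ = position {𝓢 = 𝓢} (head P)
    xs = map ρ (head P)
    ψ = rename ρ (body P)
    -- A variable occurring several times is quantified several times, to the same effect as once.
    bound = filter (λ z → ¬? (z ∈ˡ? xs)) (freeOccurrences ψ)
    φ = ∃* bound ψ

    ∉bound : ∀ {z} → z ∈ˡ xs → z ∉ˡ bound
    ∉bound z∈xs z∈bound =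
      proj₂ (∈-filter⁻ (λ z → ¬? (z ∈ˡ? xs)) {xs = freeOccurrences ψ} z∈bound) z∈xs

    xs⊆ψ : ∀ {z} → z ∈ˡ xs → z ∈ˡ freeOccurrences ψ
    xs⊆ψ z∈xs with x , x∈ , refl ← ∈-map⁻ ρ z∈xs = ∈-rename ρ (body∈ P) (head⊆ P x∈)

    free⇒∈xs : ∀ {z} → z ∈ˡ freeOccurrences φ → z ∈ˡ xs
    free⇒∈xs {z} z∈ with z∈ψ , z∉bound ← to (freeOccurrences-∃* bound ψ) z∈ =
      decidable-stable (z ∈ˡ? xs) λ z∉xs →
        z∉bound (∈-filter⁺ (λ z → ¬? (z ∈ˡ? xs)) z∈ψ z∉xs)

    freeVars≡ : freeVars φ ≡ xs
    freeVars≡ = freeVars-unique φ (position-< {𝓢 = 𝓢} (head! P)) (mk⇔ free⇒∈xs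
      (λ z∈xs → from (freeOccurrences-∃* bound ψ) (xs⊆ψ z∈xs , ∉bound z∈xs)))

  fragment⇒Equiexpressive : Equiexpressive {𝓢 = 𝓢} ℓ 𝒯 (ExistentialOf (ConjunctionOf 𝒜))
  fragment⇒Equiexpressive =
    (λ T T∈ → presentation⇒query (present T T∈)) ,
    (λ φ φ∈ → let T , T∈ , T∼φ = query-representable _ fragment φ∈
              in T , T∈ , represents⇒Equivalent _ T∼φ)

-- The two fragments

module _ {𝓢 : RelationSymbols σ} where

  GRA[e,p,s,I,J,∃]-fragment : Fragment {𝓢 = 𝓢} GRA[e,p,s,I,J,∃] RelationOrEqualityAtom
  GRA[e,p,s,I,J,∃]-fragment = record
    { rel∈   = _
    ; p⇔     = mk⇔ _ _
    ; s⇔     = mk⇔ _ _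
    ; I⇔     = mk⇔ _ _
    ; J⇔     = mk⇔ _ _
    ; ∃⇔     = mk⇔ _ _
    ; atom∈  = atom
    ; ≗⇔     = mk⇔ _ λ _ → _ ≗ _
    ; atomic = id
    }

  GRA[p,s,I,J,∃]-fragment : Fragment {𝓢 = 𝓢} GRA[p,s,I,J,∃] RelationAtom
  GRA[p,s,I,J,∃]-fragment = record
    { rel∈   = _
    ; p⇔     = mk⇔ id id
    ; s⇔     = mk⇔ id id
    ; I⇔     = mk⇔ id id
    ; J⇔     = mk⇔ id id
    ; ∃⇔     = mk⇔ id id
    ; atom∈  = atom
    -- Neither `e` nor any equality atom belongs to this fragment, so both directions are vacuous.
    ; ≗⇔     = mk⇔ (λ ()) λ ()
    ; atomic = λ where (atom R xs) → atom R xs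
    }

proposition5p1 : ∀ {σ ℓ : Level} (𝓢 : RelationSymbols σ) →
    Equiexpressive {𝓢 = 𝓢} ℓ GRA[e,p,s,I,J,∃] CQE ×
    Equiexpressive {𝓢 = 𝓢} ℓ GRA[p,s,I,J,∃] CQ
proposition5p1 𝓢 = fragment⇒Equiexpressive GRA[e,p,s,I,J,∃]-fragment ,
                   fragment⇒Equiexpressive GRA[p,s,I,J,∃]-fragment
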